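{- Let $n,k,t$ be positive integers such that $3\le t\le k\le n$ and $n\ge (t+1)(k-t+1)$. If $\mathcal{A}\subseteq\binom{[n]}{k}$ and $\mathcal{B}\subseteq\binom{[n]}{k}$ are cross-$t$-intersecting, then \[ |\mathcal{A}||\mathcal{B}|\le \binom{n-t}{k-t}^2 . \] Moreover, equality holds if and only if $\mathcal{A}=\mathcal{B}$ is a maximum $t$-intersecting subfamily of $\binom{[n]}{k}$.
   Context: $[n]=\{1,\dots,n\}$ and $\binom{[n]}{k}$ denotes the family of all $k$-element subsets of $[n]$. Two families $\mathcal{A},\mathcal{B}$ of subsets of $[n]$ are cross-$t$-intersecting if $|A\cap B|\ge t$ for all $A\in\mathcal{A}$, $B\in\mathcal{B}$. A family $\mathcal{F}$ is $t$-intersecting if $|A\cap B|\ge t$ for all $A,B\in\mathcal{F}$; a maximum $t$-intersecting subfamily of $\binom{[n]}{k}$ is one of largest possible size among all $t$-intersecting subfamilies of $\binom{[n]}{k}$. -}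

module Defs where

open import Data.Nat using (ℕ; _≤_)
open import Data.List using (List; length)
open import Data.List.Membership.Propositional using (_∈_)
open import Data.List.Relation.Unary.All using (All)
open import Data.List.Relation.Unary.Unique.Propositional using (Unique)
open import Data.Fin.Subset using (Subset; _∩_; ∣_∣)
open import Data.Product using (_×_)
open import Relation.Binary.PropositionalEquality using (_≡_)
open import Function.Bundles using (_⇔_)

-- A family of subsets of [n] is a duplicate-free list of subsets of Fin n
-- (|F| = length F).  Membership in C(n,k): a family of k-sets.
Family : ℕ → Set
Family n = List (Subset n)

KFamily : (n k : ℕ) → Family n → Set
KFamily n k F = Unique F × All (λ X → ∣ X ∣ ≡ k) F

CrossIntersecting : {n : ℕ} (t : ℕ) → Family n → Family n → Set
CrossIntersecting t A B = ∀ {X Y} → X ∈ A → Y ∈ B → t ≤ ∣ X ∩ Y ∣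

Intersecting : {n : ℕ} (t : ℕ) → Family n → Set
Intersecting t F = CrossIntersecting t F F

MaxIntersecting : (n k t : ℕ) → Family n → Set
MaxIntersecting n k t F =
  KFamily n k F × Intersecting t F ×
  (∀ (G : Family n) → KFamily n k G → Intersecting t G → length G ≤ length F)

SameFamily : {n : ℕ} → Family n → Family n → Set
SameFamily A B = ∀ X → (X ∈ A) ⇔ (X ∈ B)

{-# OPTIONS --safe #-}
-- Shifting makes A and B left compressed without changing sizes.  For compressed
-- families the proof descends on s: a family of k-sets is replaced by a family of subsets of [s],
-- where E counts for the C(n − s, k − |E|) k-sets with trace E on [s].  To pass from s to s − 1 one
-- removes the conflicts, the pairs of traces containing s that meet in t − 1 elements below s.
-- In such a pair the two traces together cover [s], so their sizes t + a and t + b satisfy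
-- a + b = s − t, and the conflicts of different a can be treated one after the other.  For one a
-- either A drops the element s from the traces involved and B discards its traces, or conversely;
-- if both choices decreased |A||B|, these traces would carry so much of the weight of A that this
-- contradicts the local LYM inequality applied to the compressed family A.  This is where
-- t ≥ 3 is used.  For a = b one may have to treat A and B alike, keeping the traces that avoid
-- s − 1; there n ≥ (t + 1)(k − t + 1) is used.  At s = t only the trace [t] is left.
--
-- Equality leaves only the families {X : |X ∩ U| ≥ t + r} with |U| = t + 2r and r ≤ 1, and this
-- is preserved when a shift is undone: the sets on which the shift acts nontrivially are
-- the vertices of a Kneser-like graph in which any two vertices have a common neighbour, and the
-- choice between shifted and unshifted set has to agree along edges of the graph.
module Submission where

open import Defs
open import Data.Nat
open import Data.Nat.Properties
open import Data.Nat.Combinatorics using (_C_; nCk+nC[k+1]≡[n+1]C[k+1]; nCn≡1; k>n⇒nCk≡0)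
open import Data.Nat.Tactic.RingSolver using (solve-∀)
import Data.Bool
open import Data.Bool using (Bool; true; false; _∧_; _∨_; not; if_then_else_; T)
open import Data.Bool.Properties using (∧-zeroʳ; ∨-zeroʳ)
open import Data.Empty using (⊥; ⊥-elim)
open import Data.Fin using (Fin; zero; suc)
open import Data.Fin.Properties using (any?)
open import Data.Fin.Subset using (Subset; _∩_; _∪_; ∣_∣; ∁; ⊤; inside; outside)
open import Data.Fin.Subset.Properties
  using (∣p∣≤n; ∣p∣≤∣x∷p∣; ∣p∩q∣≤∣p∣; ∣p∩q∣≤∣q∣; ∣⊤∣≡n; ∣p∣≡n⇒p≡⊤; ∩-assoc; ∩-comm; ∩-idem; ∩-identityʳ)
open import Data.List using ([]; _∷_; length; map; _++_)
open import Data.List.Membership.Propositional using (_∈_)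
import Data.List.Membership.DecPropositional as DecMembership
open import Data.List.Membership.Propositional.Properties using (∈-++⁻; ∈-map⁻)
open import Data.List.Properties using (length-++; length-map)
import Data.List.Relation.Unary.All as All
open import Data.List.Relation.Unary.All using ([]; _∷_)
open import Data.List.Relation.Unary.Unique.Propositional using (Unique; []; _∷_)
import Data.List.Relation.Unary.Unique.Propositional.Properties as Unique
open import Data.Product using (Σ; ∃-syntax; _×_; _,_; proj₁; proj₂)
open import Data.Sum using (_⊎_; inj₁; inj₂; [_,_]′)
open import Data.Vec using ([]; _∷_)
open import Data.Vec.Properties using (≡-dec; ∷-injectiveʳ)
open import Function using (_∘_; id; const; case_of_)
open import Function.Bundles using (_⇔_; mk⇔; Equivalence)
open import Relation.Binary.Definitions using (tri<; tri≈; tri>)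
open import Relation.Binary.PropositionalEquality
open import Relation.Nullary using (¬_; Dec; yes; no; does; contradiction)
open import Relation.Nullary.Decidable using (dec-true)

-- Put δ = (t - 1)(k - t) + n - (t + 1)(k - t + 1). For a ≤ b, let x be the weight of the traces of
-- A in question, ρ that of the rest of A, and h' = k - t - b. The ratios of consecutive weights
-- show that both choices can fail only if x (h' + 1) ≥ ρ δ, while local LYM bounds x / ρ by (t + a)
-- / b. For b ≥ 2 the two are incompatible once t + a ≤ b (t - 1). With t ≥ 3 this leaves (a, b) =
-- (0, 1), (1, 1), and (2, 2) for t = 3, and these need extra information.
--
-- The other obstacle is equality: the families change during the descent, so what is known at its
-- end must be carried back. A strictly increasing move needs nothing. A move of weight zero only
-- enlarges the families as far as positive weight is concerned, because truncation keeps the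
-- untruncated trace, so containment in a threshold family is inherited backward. In the remaining
-- possible tie, a = b = 1, the threshold family is read off directly. Only containment is tracked;
-- the product bound applied to the threshold family itself turns it into equality, without
-- computing its size.

⟦_⟧ : Bool → ℕ
⟦ true ⟧ = 1
⟦ false ⟧ = 0

-- Sums over the subsets of [n]; Boolean families and their levels

∑ : ∀ {n} → (Subset n → ℕ) → ℕ
∑ {zero}  φ = φ []
∑ {suc n} φ = ∑ (λ X → φ (outside ∷ X)) + ∑ (λ X → φ (inside ∷ X))

∑-mono : ∀ {n} {φ ψ : Subset n → ℕ} → (∀ X → φ X ≤ ψ X) → ∑ φ ≤ ∑ ψ
∑-mono {zero}  h = h []
∑-mono {suc n} h = +-mono-≤ (∑-mono (h ∘ (outside ∷_))) (∑-mono (h ∘ (inside ∷_)))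

∑-cong : ∀ {n} {φ ψ : Subset n → ℕ} → (∀ X → φ X ≡ ψ X) → ∑ φ ≡ ∑ ψ
∑-cong {zero}  h = h []
∑-cong {suc n} h = cong₂ _+_ (∑-cong (h ∘ (outside ∷_))) (∑-cong (h ∘ (inside ∷_)))

+-interchange : ∀ a b c d → (a + b) + (c + d) ≡ (a + c) + (b + d)
+-interchange = solve-∀

∑-+ : ∀ {n} (φ ψ : Subset n → ℕ) → ∑ (λ X → φ X + ψ X) ≡ ∑ φ + ∑ ψ
∑-+ {zero}  φ ψ = refl
∑-+ {suc n} φ ψ = trans
  (cong₂ _+_ (∑-+ (φ ∘ (outside ∷_)) (ψ ∘ (outside ∷_))) (∑-+ (φ ∘ (inside ∷_)) (ψ ∘ (inside ∷_))))
  (+-interchange (∑ (φ ∘ (outside ∷_))) _ (∑ (φ ∘ (inside ∷_))) _)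

∑-* : ∀ {n} (φ : Subset n → ℕ) c → ∑ (λ X → φ X * c) ≡ ∑ φ * c
∑-* {zero}  φ c = refl
∑-* {suc n} φ c = trans (cong₂ _+_ (∑-* (φ ∘ (outside ∷_)) c) (∑-* (φ ∘ (inside ∷_)) c)) (sym (*-distribʳ-+ c (∑ (φ ∘ (outside ∷_))) _))

∑-zero : ∀ {n} {φ : Subset n → ℕ} → (∀ X → φ X ≡ 0) → ∑ φ ≡ 0
∑-zero {zero}  h = h []
∑-zero {suc n} h = cong₂ _+_ (∑-zero (h ∘ (outside ∷_))) (∑-zero (h ∘ (inside ∷_)))

term≤∑ : ∀ {n} (φ : Subset n → ℕ) X → φ X ≤ ∑ φ
term≤∑ φ [] = ≤-refl
term≤∑ φ (outside ∷ X) = ≤-trans (term≤∑ (φ ∘ (outside ∷_)) X) (m≤m+n _ _)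
term≤∑ φ (inside ∷ X)  = ≤-trans (term≤∑ (φ ∘ (inside ∷_)) X) (m≤n+m _ _)

∑>0⇒∃ : ∀ {n} (φ : Subset n → ℕ) → 0 < ∑ φ → ∃[ X ] 0 < φ X
∑>0⇒∃ {zero}  φ p = [] , p
∑>0⇒∃ {suc n} φ p with ∑ (φ ∘ (outside ∷_)) in eq
... | suc _ with X , q ← ∑>0⇒∃ (φ ∘ (outside ∷_)) (subst (0 <_) (sym eq) z<s) = outside ∷ X , q
... | zero  with X , q ← ∑>0⇒∃ (φ ∘ (inside ∷_)) p = inside ∷ X , q

∑-squeeze : ∀ {n} {φ ψ : Subset n → ℕ} → (∀ X → φ X ≤ ψ X) → ∑ ψ ≤ ∑ φ → ∀ X → φ X ≡ ψ X
∑-squeeze h le [] = ≤-antisym (h []) le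
∑-squeeze {suc n} {φ} {ψ} h le (b ∷ X) = helper b
  where
  lo = ∑-mono (h ∘ (outside ∷_))
  hi = ∑-mono (h ∘ (inside ∷_))
  helper : ∀ b → φ (b ∷ X) ≡ ψ (b ∷ X)
  helper false = ∑-squeeze (h ∘ (outside ∷_))
    (+-cancelʳ-≤ (∑ (φ ∘ (inside ∷_))) _ _ (≤-trans (+-monoʳ-≤ _ hi) le)) X
  helper true  = ∑-squeeze (h ∘ (inside ∷_))
    (+-cancelˡ-≤ (∑ (φ ∘ (outside ∷_))) _ _ (≤-trans (+-monoˡ-≤ _ lo) le)) X

Fam : ℕ → Set
Fam n = Subset n → Bool

level : ∀ {n} → ℕ → Fam n
level e X = ∣ X ∣ ≡ᵇ e

≡ᵇ-refl : ∀ n → (n ≡ᵇ n) ≡ true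
≡ᵇ-refl zero = refl
≡ᵇ-refl (suc n) = ≡ᵇ-refl n

≡ᵇ-sound : ∀ m n → (m ≡ᵇ n) ≡ true → m ≡ n
≡ᵇ-sound zero zero _ = refl
≡ᵇ-sound (suc m) (suc n) p = cong suc (≡ᵇ-sound m n p)

level-true : ∀ {n} (X : Subset n) {e} → ∣ X ∣ ≡ e → level e X ≡ true
level-true X refl = ≡ᵇ-refl ∣ X ∣

∧-split : ∀ {a b} → a ∧ b ≡ true → a ≡ true × b ≡ true
∧-split {true} {true} _ = refl , refl

∧-pair : ∀ {a b} → a ≡ true → b ≡ true → a ∧ b ≡ true
∧-pair refl refl = refl

∨-split : ∀ {a b} → a ∨ b ≡ true → a ≡ true ⊎ b ≡ true
∨-split {true} _ = inj₁ refl
∨-split {false} p = inj₂ p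

∨-inl : ∀ {a b} → a ≡ true → a ∨ b ≡ true
∨-inl refl = refl

∨-inr : ∀ {a b} → b ≡ true → a ∨ b ≡ true
∨-inr {a} refl = ∨-zeroʳ a

not-true : ∀ {a} → not a ≡ true → a ≡ true → ⊥
not-true {false} _ ()
not-true {true} ()

⟦⟧-mono : ∀ {a b} → (a ≡ true → b ≡ true) → ⟦ a ⟧ ≤ ⟦ b ⟧
⟦⟧-mono {false} h = z≤n
⟦⟧-mono {true}  h rewrite h refl = ≤-refl

⟦⟧>0 : ∀ {a} → 0 < ⟦ a ⟧ → a ≡ true
⟦⟧>0 {true} _ = refl

true⇒⟦⟧≡1 : ∀ {a} → a ≡ true → ⟦ a ⟧ ≡ 1
true⇒⟦⟧≡1 refl = refl

# : ∀ {n} → Fam n → ℕ → ℕ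
# f e = ∑ (λ X → ⟦ f X ∧ level e X ⟧)

#≡0⇒ : ∀ {n} (f : Fam n) {e} → # f e ≡ 0 → ∀ X → ∣ X ∣ ≡ e → f X ≡ true → ⊥
#≡0⇒ f {e} p X sz fX = <-irrefl refl (subst (_< 1) (sym one) (s≤s (subst (⟦ f X ∧ level e X ⟧ ≤_) p (term≤∑ _ X))))
  where
  one : 1 ≡ ⟦ f X ∧ level e X ⟧
  one = sym (true⇒⟦⟧≡1 (∧-pair fX (level-true X sz)))

#>0⇒∃ : ∀ {n} (f : Fam n) {e} → 0 < # f e → ∃[ X ] f X ≡ true × ∣ X ∣ ≡ e
#>0⇒∃ f p with X , q ← ∑>0⇒∃ _ p with fX , l ← ∧-split {f X} (⟦⟧>0 q) = X , fX , ≡ᵇ-sound _ _ l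

-- Binomial coefficients

nC0≡1 : ∀ n → n C 0 ≡ 1
nC0≡1 zero = refl
nC0≡1 (suc n) = refl

pascal : ∀ n k → suc n C suc k ≡ n C k + n C suc k
pascal n k = sym (nCk+nC[k+1]≡[n+1]C[k+1] n k)

-- Written without subtraction, (j + 1) C(n, j + 1) = (n - j) C(n, j) also holds for j > n, so the
-- induction by Pascal's rule needs no side condition.
absorb : ∀ n j → suc j * (n C suc j) + j * (n C j) ≡ n * (n C j)
absorb zero zero = refl
absorb zero (suc j) rewrite k>n⇒nCk≡0 {0} {suc j} z<s | k>n⇒nCk≡0 {0} {suc (suc j)} z<s = lem j
  where
  lem : ∀ j → suc (suc j) * 0 + suc j * 0 ≡ 0
  lem = solve-∀
absorb (suc n) zero rewrite pascal n 0 | nC0≡1 n | +-identityʳ (1 * suc (n C 1)) = lem (n C 1) (trans (sym (+-identityʳ _)) (trans (absorb n zero) (cong (n *_) (nC0≡1 n))))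
  where
  lem : ∀ c → 1 * c ≡ n * 1 → 1 * suc c ≡ suc n * 1
  lem c p = trans (*-identityˡ _) (trans (cong suc (trans (sym (*-identityˡ c)) (trans p (*-identityʳ n)))) (sym (*-identityʳ _)))
absorb (suc n) (suc j) rewrite pascal n (suc j) | pascal n j = lem n j (n C j) (n C suc j) (n C suc (suc j)) (absorb n j) (absorb n (suc j))
  where
  lem : ∀ n j x y z → suc j * y + j * x ≡ n * x → suc (suc j) * z + suc j * y ≡ n * y →
        suc (suc j) * (y + z) + suc j * (x + y) ≡ suc n * (x + y)
  lem n j x y z p q = trans (r1 j x y z) (trans (cong₂ _+_ (cong₂ _+_ p q) refl) (r2 n x y))
    where
    r1 : ∀ j x y z → suc (suc j) * (y + z) + suc j * (x + y) ≡ ((suc j * y + j * x) + (suc (suc j) * z + suc j * y)) + (x + y)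
    r1 = solve-∀
    r2 : ∀ n x y → (n * x + n * y) + (x + y) ≡ suc n * (x + y)
    r2 = solve-∀

C-ratio : ∀ {n j q} → n ≡ j + q → (n C suc j) * suc j ≡ q * (n C j)
C-ratio {n} {j} {q} refl = +-cancelʳ-≡ (j * (n C j)) _ _ (trans (cong (_+ j * (n C j)) (*-comm (n C suc j) (suc j)))
  (trans (absorb n j) (trans (*-distribʳ-+ (n C j) j q) (+-comm (j * (n C j)) _))))

C>0 : ∀ {n k} → k ≤ n → 0 < n C k
C>0 {n} z≤n rewrite nC0≡1 n = z<s
C>0 {suc n} {suc k} (s≤s p) rewrite pascal n k = ≤-trans (C>0 p) (m≤m+n _ _)

[1+n]Cn≡1+n : ∀ n → suc n C n ≡ suc n
[1+n]Cn≡1+n zero = refl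
[1+n]Cn≡1+n (suc n) rewrite pascal (suc n) n | [1+n]Cn≡1+n n | nCn≡1 (suc n) = +-comm (suc n) 1

#-level : ∀ n e → ∑ (λ (X : Subset n) → ⟦ level e X ⟧) ≡ n C e
#-level zero zero = refl
#-level zero (suc e) = sym (k>n⇒nCk≡0 {0} {suc e} z<s)
#-level (suc n) zero = trans (cong₂ _+_ (#-level n 0) (∑-zero {n} (λ _ → refl))) (trans (+-identityʳ _) (nC0≡1 n))
#-level (suc n) (suc e) = trans (cong₂ _+_ (#-level n (suc e)) (#-level n e)) (trans (+-comm _ (n C e)) (sym (pascal n e)))

#≤C : ∀ {n} (f : Fam n) e → # f e ≤ n C e
#≤C {n} f e = ≤-trans (∑-mono (λ X → ⟦⟧-mono (λ p → proj₂ (∧-split {f X} p)))) (≤-reflexive (#-level n e))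

-- wt N k e = C(N, k − e), and 0 for e > k: the number of k-sets of [s + N] with a
-- given trace of size e on [s].
wt : ℕ → ℕ → ℕ → ℕ
wt N k zero = N C k
wt N zero (suc e) = 0
wt N (suc k) (suc e) = wt N k e

wt-pascal : ∀ N k e → wt (suc N) k e ≡ wt N k e + wt N k (suc e)
wt-pascal N zero zero = trans (nC0≡1 (suc N)) (sym (trans (+-identityʳ _) (nC0≡1 N)))
wt-pascal N (suc k) zero = trans (pascal N k) (+-comm (N C k) _)
wt-pascal N zero (suc e) = refl
wt-pascal N (suc k) (suc e) = wt-pascal N k e

wt-+ : ∀ N e j → wt N (e + j) e ≡ N C j
wt-+ N zero j = refl
wt-+ N (suc e) j = wt-+ N e j

wt>0⇒≤ : ∀ N k e → 0 < wt N k e → e ≤ k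
wt>0⇒≤ N k zero _ = z≤n
wt>0⇒≤ N (suc k) (suc e) p = s≤s (wt>0⇒≤ N k e p)

wt0 : ∀ k e → wt 0 k e ≡ ⟦ e ≡ᵇ k ⟧
wt0 zero zero = refl
wt0 (suc k) zero = k>n⇒nCk≡0 {0} {suc k} z<s
wt0 zero (suc e) = refl
wt0 (suc k) (suc e) = wt0 k e

W : ∀ {s} → ℕ → ℕ → Fam s → ℕ
W N k f = ∑ (λ X → ⟦ f X ⟧ * wt N k ∣ X ∣)

_↾_ : ∀ {n} → Fam (suc n) → Bool → Fam n
(f ↾ b) E = f (b ∷ E)

-- Upper shadows and the local LYM inequality

data Add : ∀ {n} → Subset n → Subset n → Set where
  here  : ∀ {n} {E : Subset n} → Add (outside ∷ E) (inside ∷ E)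
  there : ∀ {n b} {E G : Subset n} → Add E G → Add (b ∷ E) (b ∷ G)

Add-size : ∀ {n} {E G : Subset n} → Add E G → ∣ G ∣ ≡ suc ∣ E ∣
Add-size here = refl
Add-size (there {b = false} p) = Add-size p
Add-size (there {b = true} p) = cong suc (Add-size p)

size-∁ : ∀ {n} (X : Subset n) → ∣ X ∣ + ∣ ∁ X ∣ ≡ n
size-∁ [] = refl
size-∁ (false ∷ X) = trans (+-suc _ _) (cong suc (size-∁ X))
size-∁ (true ∷ X) = cong suc (size-∁ X)

-- Both sides count the pairs Add E G, weighted by φ E and by ψ G.
double-count : ∀ {n} (φ ψ : Subset n → ℕ) → (∀ {E G} → Add E G → φ E ≤ ψ G) →
               ∑ (λ E → φ E * ∣ ∁ E ∣) ≤ ∑ (λ G → ψ G * ∣ G ∣)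
double-count {zero} φ ψ h = ≤-reflexive (trans (*-zeroʳ (φ [])) (sym (*-zeroʳ (ψ []))))
double-count {suc n} φ ψ h = begin
  ∑ (λ E → φ₀ E * suc ∣ ∁ E ∣) + ∑ (λ E → φ₁ E * ∣ ∁ E ∣)
    ≡⟨ cong (_+ ∑ (λ E → φ₁ E * ∣ ∁ E ∣)) (trans (∑-cong (λ E → *-suc (φ₀ E) ∣ ∁ E ∣)) (∑-+ φ₀ _)) ⟩
  (∑ φ₀ + ∑ (λ E → φ₀ E * ∣ ∁ E ∣)) + ∑ (λ E → φ₁ E * ∣ ∁ E ∣)
    ≤⟨ +-mono-≤ (+-mono-≤ (∑-mono {φ = φ₀} {ψ₁} (λ E → h here)) (double-count φ₀ ψ₀ (h ∘ there))) (double-count φ₁ ψ₁ (h ∘ there)) ⟩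
  (∑ ψ₁ + ∑ (λ G → ψ₀ G * ∣ G ∣)) + ∑ (λ G → ψ₁ G * ∣ G ∣)
    ≡⟨ swap (∑ ψ₁) _ _ ⟩
  ∑ (λ G → ψ₀ G * ∣ G ∣) + (∑ ψ₁ + ∑ (λ G → ψ₁ G * ∣ G ∣))
    ≡⟨ cong (∑ (λ G → ψ₀ G * ∣ G ∣) +_) (sym (trans (∑-cong (λ E → *-suc (ψ₁ E) ∣ E ∣)) (∑-+ ψ₁ _))) ⟩
  ∑ (λ G → ψ₀ G * ∣ G ∣) + ∑ (λ G → ψ₁ G * suc ∣ G ∣) ∎
  where
  open ≤-Reasoning
  φ₀ = φ ∘ (outside ∷_)
  φ₁ = φ ∘ (inside ∷_)
  ψ₀ = ψ ∘ (outside ∷_)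
  ψ₁ = ψ ∘ (inside ∷_)
  swap : ∀ a b c → (a + b) + c ≡ b + (a + c)
  swap = solve-∀

-- Local LYM for the upper shadow: an e-set has a = n - e extensions by one element, and an (e +
-- 1)-set extends e + 1 sets. Restriction to one level makes the factors in `double-count` constant.
shadow : ∀ {n} (f g : Fam n) {a e} → a + e ≡ n →
         (∀ {E G} → Add E G → f E ≡ true → g G ≡ true) → # f e * a ≤ # g (suc e) * suc e
shadow {n} f g {a} {e} a+e h = begin
  # f e * a ≡⟨ sym (∑-* (λ E → ⟦ f E ∧ level e E ⟧) a) ⟩
  ∑ (λ E → ⟦ f E ∧ level e E ⟧ * a) ≡⟨ ∑-cong left ⟩
  ∑ (λ E → ⟦ f E ∧ level e E ⟧ * ∣ ∁ E ∣) ≤⟨ double-count _ _ mono ⟩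
  ∑ (λ G → ⟦ g G ∧ level (suc e) G ⟧ * ∣ G ∣) ≡⟨ ∑-cong right ⟩
  ∑ (λ G → ⟦ g G ∧ level (suc e) G ⟧ * suc e) ≡⟨ ∑-* (λ G → ⟦ g G ∧ level (suc e) G ⟧) (suc e) ⟩
  # g (suc e) * suc e ∎
  where
  open ≤-Reasoning
  left : ∀ E → ⟦ f E ∧ level e E ⟧ * a ≡ ⟦ f E ∧ level e E ⟧ * ∣ ∁ E ∣
  left E with f E ∧ level e E in eq
  ... | false = refl
  ... | true  = cong (_+ 0) (+-cancelˡ-≡ e _ _ (trans (+-comm e a) (trans a+e (trans (sym (size-∁ E))
                  (cong (_+ ∣ ∁ E ∣) (≡ᵇ-sound _ _ (proj₂ (∧-split {f E} eq))))))))
  right : ∀ G → ⟦ g G ∧ level (suc e) G ⟧ * ∣ G ∣ ≡ ⟦ g G ∧ level (suc e) G ⟧ * suc e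
  right G with g G ∧ level (suc e) G in eq
  ... | false = refl
  ... | true  = cong (_+ 0) (≡ᵇ-sound _ _ (proj₂ (∧-split {g G} eq)))
  mono : ∀ {E G} → Add E G → ⟦ f E ∧ level e E ⟧ ≤ ⟦ g G ∧ level (suc e) G ⟧
  mono {E} {G} ad = ⟦⟧-mono λ p → let fE , l = ∧-split {f E} p in
    ∧-pair (h ad fE) (level-true G (trans (Add-size ad) (cong suc (≡ᵇ-sound _ _ l))))

-- Left compression and conflicts

-- Y arises from X by replacing the element at the head of two adjacent coordinates
-- by the next one.  Coordinates are listed from the largest element of [n] to the
-- smallest, so this is an elementary left shift.
data Sw : ∀ {n} → Subset n → Subset n → Set where
  here  : ∀ {n} {E : Subset n} → Sw (inside ∷ outside ∷ E) (outside ∷ inside ∷ E)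
  there : ∀ {n b} {E G : Subset n} → Sw E G → Sw (b ∷ E) (b ∷ G)

Sw-size : ∀ {n} {X Y : Subset n} → Sw X Y → ∣ Y ∣ ≡ ∣ X ∣
Sw-size here = refl
Sw-size (there {b = false} p) = Sw-size p
Sw-size (there {b = true} p) = cong suc (Sw-size p)

LeftCompressed : ∀ {n} → Fam n → Set
LeftCompressed f = ∀ {X Y} → Sw X Y → f X ≡ true → f Y ≡ true

LC-↾ : ∀ {n} {f : Fam (suc n)} {b} → LeftCompressed f → LeftCompressed (f ↾ b)
LC-↾ lc p = lc (there p)

LC-∧ : ∀ {n} {f g : Fam n} → LeftCompressed f → LeftCompressed g → LeftCompressed (λ X → f X ∧ g X)
LC-∧ {f = f} lf lg {X} p q = let a , b = ∧-split {f X} q in ∧-pair (lf p a) (lg p b)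

LC-∨ : ∀ {n} {f g : Fam n} → LeftCompressed f → LeftCompressed g → LeftCompressed (λ X → f X ∨ g X)
LC-∨ {f = f} lf lg {X} p q = [ ∨-inl ∘ lf p , ∨-inr ∘ lg p ]′ (∨-split {f X} q)

LC-level : ∀ {n} e → LeftCompressed (level {n} e)
LC-level e {X} {Y} p q = level-true Y (trans (Sw-size p) (≡ᵇ-sound _ _ q))

LC-¬level : ∀ {n} e → LeftCompressed {n} (not ∘ level e)
LC-¬level e {X} {Y} p q = subst (λ s → not (s ≡ᵇ e) ≡ true) (sym (Sw-size p)) q

-- The largest element travels to a missing place by adjacent shifts. If the next place is occupied,
-- its occupant moves first and the largest element takes the freed place.
LC-add : ∀ {n} {f : Fam (suc n)} → LeftCompressed f → ∀ {E G} → Add E G →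
         f (inside ∷ E) ≡ true → f (outside ∷ G) ≡ true
LC-add lc here q = lc here q
LC-add {f = f} lc (there {b = false} p) q = LC-add {f = f ↾ outside} (LC-↾ lc) p (lc here q)
LC-add {f = f} lc (there {b = true} p) q = lc here (LC-add {f = f ↾ inside} (LC-↾ lc) p q)

Cross : ∀ {n} → ℕ → Fam n → Fam n → Set
Cross t f g = ∀ X Y → f X ≡ true → g Y ≡ true → t ≤ ∣ X ∩ Y ∣

Cross-sym : ∀ {n t} {f g : Fam n} → Cross t f g → Cross t g f
Cross-sym c X Y p q = subst (λ Z → _ ≤ ∣ Z ∣) (∩-comm Y X) (c Y X q p)

-- The second alternative is inclusion-exclusion for E ∪ E' = [n]. In the first, the added element
-- lies outside E', so the intersection stays the same.
missed-or-covering : ∀ {n} (E E' : Subset n) →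
  (∃[ G ] Add E G × G ∩ E' ≡ E ∩ E') ⊎ (∣ E ∣ + ∣ E' ∣ ≡ n + ∣ E ∩ E' ∣)
missed-or-covering [] [] = inj₂ refl
missed-or-covering (false ∷ E) (false ∷ E') = inj₁ (true ∷ E , here , refl)
missed-or-covering (a ∷ E) (b ∷ E') with missed-or-covering E E'
... | inj₁ (G , ad , eq) = inj₁ (a ∷ G , there ad , cong (a ∧ b ∷_) eq)
missed-or-covering (false ∷ E) (true ∷ E') | inj₂ eq = inj₂ (trans (+-suc _ _) (cong suc eq))
missed-or-covering (true ∷ E) (false ∷ E') | inj₂ eq = inj₂ (cong suc eq)
missed-or-covering (true ∷ E) (true ∷ E') | inj₂ eq = inj₂ (cong suc (trans (+-suc _ _) (trans (cong suc eq) (sym (+-suc _ _)))))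
missed-or-covering (false ∷ E) (false ∷ E') | inj₂ eq = inj₁ (true ∷ E , here , refl)

module _ {u t : ℕ} {f g : Fam (suc u)} (lf : LeftCompressed f) (cr : Cross (suc t) f g) where

  -- If an element x is missed by E ∪ E', then shifting the largest element of inside ∷ E
  -- to x turns the intersection with inside ∷ E' into E ∩ E'.
  conflict : ∀ E E' → f (inside ∷ E) ≡ true → g (inside ∷ E') ≡ true →
             suc t ≤ ∣ E ∩ E' ∣ ⊎ (∣ E ∣ + ∣ E' ∣ ≡ u + t × ∣ E ∩ E' ∣ ≡ t)
  conflict E E' p q with missed-or-covering E E'
  ... | inj₁ (G , ad , eq) = inj₁ (subst (λ Z → suc t ≤ ∣ Z ∣) eq (cr (outside ∷ G) (inside ∷ E') (LC-add lf ad p) q))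
  ... | inj₂ eq with suc t ≤? ∣ E ∩ E' ∣
  ...   | yes le = inj₁ le
  ...   | no nle = inj₂ (trans eq (cong (u +_) t≡) , t≡)
    where
    t≡ = ≤-antisym (≤-pred (≰⇒> nle)) (≤-pred (cr _ _ p q))

-- Let D be the set of E of size e with inside ∷ E ∈ f, outside ∷ E ∉ f.  The move drops the
-- largest element from inside ∷ E if E ∈ D ∩ P, and discards inside ∷ E if E ∈ D ∖ P.
move : ∀ {u} → ℕ → Fam u → Fam (suc u) → Fam (suc u)
move e P f (false ∷ E) = f (outside ∷ E) ∨ (f (inside ∷ E) ∧ (level e E ∧ P E))
move e P f (true ∷ E)  = f (inside ∷ E) ∧ (f (outside ∷ E) ∨ (not (level e E) ∨ P E))

boundary : ∀ {u} → Fam (suc u) → Fam u → Fam u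
boundary f P E = P E ∧ (f (inside ∷ E) ∧ not (f (outside ∷ E)))

W-split : ∀ {u} N k (f : Fam (suc u)) →
  W N k f ≡ ∑ (λ E → ⟦ f (outside ∷ E) ⟧ * wt N k ∣ E ∣ + ⟦ f (inside ∷ E) ⟧ * wt N k (suc ∣ E ∣))
W-split N k f = sym (∑-+ (λ E → ⟦ f (outside ∷ E) ⟧ * wt N k ∣ E ∣) _)

-- For E in D ∩ P, `inside ∷ E` is kept and `outside ∷ E` added, a gain of `wt N k e`; for the other
-- E in D the loss is `wt N k (suc e)`. Losses stand on the left to avoid subtraction.
move-W : ∀ {u} N k e (P : Fam u) (f : Fam (suc u)) →
  W N k (move e P f) + # (boundary f (not ∘ P)) e * wt N k (suc e) ≡ W N k f + # (boundary f P) e * wt N k e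
move-W N k e P f = begin
  W N k (move e P f) + # (boundary f (not ∘ P)) e * wt N k (suc e)
    ≡⟨ collect (move e P f) (boundary f (not ∘ P)) (wt N k (suc e)) ⟩
  ∑ (λ E → term (move e P f) E + ⟦ boundary f (not ∘ P) E ∧ level e E ⟧ * wt N k (suc e))
    ≡⟨ ∑-cong pointwise ⟩
  ∑ (λ E → term f E + ⟦ boundary f P E ∧ level e E ⟧ * wt N k e)
    ≡⟨ sym (collect f (boundary f P) (wt N k e)) ⟩
  W N k f + # (boundary f P) e * wt N k e ∎
  where
  open ≡-Reasoning
  term : Fam _ → Subset _ → ℕ
  term h E = ⟦ h (outside ∷ E) ⟧ * wt N k ∣ E ∣ + ⟦ h (inside ∷ E) ⟧ * wt N k (suc ∣ E ∣)
  collect : ∀ h B c → W N k h + # B e * c ≡ ∑ (λ E → term h E + ⟦ B E ∧ level e E ⟧ * c)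
  collect h B c = trans (cong₂ _+_ (W-split N k h) (sym (∑-* (λ E → ⟦ B E ∧ level e E ⟧) c))) (sym (∑-+ (term h) _))
  r₁ : ∀ x y → 1 * x + 1 * y + 0 ≡ 0 + 1 * y + 1 * x
  r₁ = solve-∀
  r₂ : ∀ y → 0 + 0 + 1 * y ≡ 0 + 1 * y + 0
  r₂ = solve-∀
  pointwise : ∀ E → term (move e P f) E + ⟦ boundary f (not ∘ P) E ∧ level e E ⟧ * wt N k (suc e)
                  ≡ term f E + ⟦ boundary f P E ∧ level e E ⟧ * wt N k e
  pointwise E with f (outside ∷ E) | f (inside ∷ E) | level e E in eq | P E
  ... | true  | true  | true  | true  = refl
  ... | true  | true  | true  | false = refl
  ... | true  | true  | false | true  = refl
  ... | true  | true  | false | false = refl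
  ... | true  | false | true  | true  = refl
  ... | true  | false | true  | false = refl
  ... | true  | false | false | true  = refl
  ... | true  | false | false | false = refl
  ... | false | true  | true  | true  rewrite ≡ᵇ-sound ∣ E ∣ e eq = r₁ (wt N k e) (wt N k (suc e))
  ... | false | true  | true  | false rewrite ≡ᵇ-sound ∣ E ∣ e eq = r₂ (wt N k (suc e))
  ... | false | true  | false | true  = refl
  ... | false | true  | false | false = refl
  ... | false | false | true  | true  = refl
  ... | false | false | true  | false = refl
  ... | false | false | false | true  = refl
  ... | false | false | false | false = refl

move-LC : ∀ {u} e {P : Fam u} {f : Fam (suc u)} → LeftCompressed P → LeftCompressed f → LeftCompressed (move e P f)
move-LC e {P} {f} lP lf {X} here q =
  ∨-inl (lf here (proj₁ (∧-split {f X} q)))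
move-LC e {P} {f} lP lf (there {b = false} p) q =
  LC-∨ {f = f ↾ outside} (LC-↾ lf) (LC-∧ {f = f ↾ inside} (LC-↾ lf) (LC-∧ {f = level e} (LC-level e) lP)) p q
move-LC e {P} {f} lP lf (there {b = true} p) q =
  LC-∧ {f = f ↾ inside} (LC-↾ lf) (LC-∨ {f = f ↾ outside} (LC-↾ lf) (LC-∨ {f = not ∘ level e} (LC-¬level e) lP)) p q

Resolved : ∀ {u} → ℕ → ℕ → Fam (suc u) → Fam (suc u) → Set
Resolved {u} t e f g = ∀ E E' → ∣ E ∣ ≡ e → f (inside ∷ E) ≡ true → g (inside ∷ E') ≡ true →
  ∣ E ∣ + ∣ E' ∣ ≡ u + t → suc t ≤ ∣ E ∩ E' ∣

-- What P and Q owe each other: a pair truncated on both sides must not be a conflict. Truncation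
-- against discarding satisfies this vacuously.
Compatible : ∀ {u} → ℕ → (f g : Fam (suc u)) → (P Q : Fam u) → Set
Compatible t f g P Q = ∀ E E' → f (inside ∷ E) ≡ true → g (inside ∷ E') ≡ true →
  P E ≡ true → Q E' ≡ true → suc t ≤ ∣ E ∩ E' ∣

Compatible-sym : ∀ {u t} {f g : Fam (suc u)} {P Q} → Compatible t f g P Q → Compatible t g f Q P
Compatible-sym c E E' p q a b = subst (λ Z → _ ≤ ∣ Z ∣) (∩-comm E' E) (c E' E q p b a)

module _ {u t e e' : ℕ} {f g : Fam (suc u)} {P Q : Fam u}
         (lf : LeftCompressed f) (cr : Cross (suc t) f g) (ee' : e + e' ≡ u + t)
         (cp : Compatible t f g P Q) where

  private
    partner : ∀ (E E' : Subset u) → ∣ E ∣ ≡ e → ∣ E ∣ + ∣ E' ∣ ≡ u + t → ∣ E' ∣ ≡ e'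
    partner E E' refl eq = +-cancelˡ-≡ ∣ E ∣ _ _ (trans eq (sym ee'))

  -- If `inside ∷ E'` conflicts with `inside ∷ E`, then E' has size e' and `outside ∷ E'` is not in
  -- g. So it can survive only through Q, where compatibility applies.
  move-separates : ∀ E E' → ∣ E ∣ ≡ e → f (inside ∷ E) ≡ true → P E ≡ true →
                   move e' Q g (inside ∷ E') ≡ true → suc t ≤ ∣ E ∩ E' ∣
  move-separates E E' sz p PE m with ∧-split {g (inside ∷ E')} m
  ... | q , r with ∨-split {g (outside ∷ E')} r
  ...   | inj₁ q₀ = cr (inside ∷ E) (outside ∷ E') p q₀
  ...   | inj₂ r' with ∨-split {not (level e' E')} r'
  ...     | inj₂ QE = cp E E' p q PE QE
  ...     | inj₁ nl with conflict {f = f} {g} lf cr E E' p q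
  ...       | inj₁ le = le
  ...       | inj₂ (eq , _) = ⊥-elim (not-true nl (level-true E' (partner E E' sz eq)))

  move-resolved : Resolved t e (move e P f) (move e' Q g)
  move-resolved E E' sz m m' eq with ∧-split {f (inside ∷ E)} m
  ... | p , r with ∨-split {f (outside ∷ E)} r
  ...   | inj₁ p₀ = cr (outside ∷ E) (inside ∷ E') p₀ (proj₁ (∧-split {g (inside ∷ E')} m'))
  ...   | inj₂ r' with ∨-split {not (level e E)} r'
  ...     | inj₁ nl = ⊥-elim (not-true nl (level-true E sz))
  ...     | inj₂ PE = move-separates E E' sz p PE m'

move-cross : ∀ {u t e e' : ℕ} {f g : Fam (suc u)} {P Q : Fam u} →
  LeftCompressed f → LeftCompressed g → Cross (suc t) f g → e + e' ≡ u + t → Compatible t f g P Q →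
  Cross (suc t) (move e P f) (move e' Q g)
move-cross {e = e} {e'} {f} {g} {P} {Q} lf lg cr ee' cp = go
  where
  left : ∀ E E' → f (inside ∷ E) ∧ (level e E ∧ P E) ≡ true → move e' Q g (inside ∷ E') ≡ true → _ ≤ ∣ E ∩ E' ∣
  left E E' p q with ∧-split {f (inside ∷ E)} p
  ... | p₁ , r with ∧-split {level e E} r
  ... | l , PE = move-separates lf cr ee' cp E E' (≡ᵇ-sound ∣ E ∣ e l) p₁ PE q
  right : ∀ E E' → move e P f (inside ∷ E) ≡ true → g (inside ∷ E') ∧ (level e' E' ∧ Q E') ≡ true → _ ≤ ∣ E ∩ E' ∣
  right E E' p q with ∧-split {g (inside ∷ E')} q
  ... | q₁ , r with ∧-split {level e' E'} r
  ... | l , QE = subst (λ Z → _ ≤ ∣ Z ∣) (∩-comm E' E)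
        (move-separates lg (Cross-sym cr) (trans (+-comm e' e) ee') (Compatible-sym {f = f} {g} cp) E' E (≡ᵇ-sound ∣ E' ∣ e' l) q₁ QE p)
  go : Cross _ (move e P f) (move e' Q g)
  go (true ∷ E) (true ∷ E') p q =
    cr _ _ (proj₁ (∧-split {f (inside ∷ E)} p)) (proj₁ (∧-split {g (inside ∷ E')} q))
  go (false ∷ E) (true ∷ E') p q with ∨-split {f (outside ∷ E)} p
  ... | inj₁ p₀ = cr (outside ∷ E) (inside ∷ E') p₀ (proj₁ (∧-split {g (inside ∷ E')} q))
  ... | inj₂ p₁ = left E E' p₁ q
  go (true ∷ E) (false ∷ E') p q with ∨-split {g (outside ∷ E')} q
  ... | inj₁ q₀ = cr (inside ∷ E) (outside ∷ E') (proj₁ (∧-split {f (inside ∷ E)} p)) q₀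
  ... | inj₂ q₁ = right E E' p q₁
  go (false ∷ E) (false ∷ E') p q with ∨-split {f (outside ∷ E)} p | ∨-split {g (outside ∷ E')} q
  ... | inj₁ p₀ | inj₁ q₀ = cr _ _ p₀ q₀
  ... | inj₁ p₀ | inj₂ q₁ = cr (outside ∷ E) (inside ∷ E') p₀ (proj₁ (∧-split {g (inside ∷ E')} q₁))
  ... | inj₂ p₁ | inj₁ q₀ = cr (inside ∷ E) (outside ∷ E') (proj₁ (∧-split {f (inside ∷ E)} p₁)) q₀
  ... | inj₂ p₁ | inj₂ q₁ = left E E' p₁ (∧-pair gE' (∨-inr {a = g (outside ∷ E')} (∨-inr {a = not (level e' E')} QE)))
    where
    gE' = proj₁ (∧-split {g (inside ∷ E')} q₁)
    QE = proj₂ (∧-split {level e' E'} (proj₂ (∧-split {g (inside ∷ E')} q₁)))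

-- Resolving the conflicts of one size

-- Here x and y are the weights lost by discarding, x₀ and y₀ those gained by truncating, ρ and σ
-- what remains. If the first alternative fails, then x₀ σ ≤ (ρ + x) y. Inserted into the second,
-- multiplied by kb (δ + kb), this leaves, up to the factor y, x kb (δ + ka + kb) + ρ ka kb < ρ (δ +
-- ka)(δ + kb). Since (δ + ka)(δ + kb) = δ (δ + ka + kb) + ka kb, that is x kb < ρ δ.
improve : ∀ x x₀ y y₀ ρ σ δ ka kb → x₀ * ka ≡ (δ + kb) * x → y₀ * kb ≡ (δ + ka) * y →
          0 < kb → 0 < y → x * kb < ρ * δ →
          (ρ + x) * (σ + y) < (ρ + x + x₀) * σ ⊎ (ρ + x) * (σ + y) < ρ * (σ + y + y₀)
improve x x₀ y@(suc y′) y₀ ρ σ δ ka kb@(suc kb′) hx hy _ _ small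
  with (ρ + x) * (σ + y) <? (ρ + x + x₀) * σ
... | yes p = inj₁ p
... | no np = inj₂ (subst₂ _<_ (sym (e₁ ρ x (σ + y))) (sym (e₂ ρ (σ + y) y₀)) (+-monoʳ-< (ρ * (σ + y)) core))
  where
  e₁ : ∀ ρ x s → (ρ + x) * s ≡ ρ * s + x * s
  e₁ = solve-∀
  e₂ : ∀ ρ s y₀ → ρ * (s + y₀) ≡ ρ * s + ρ * y₀
  e₂ = solve-∀
  e₃ : ∀ ρ x x₀ σ → (ρ + x + x₀) * σ ≡ (ρ + x) * σ + x₀ * σ
  e₃ = solve-∀
  e₄ : ∀ r σ y → r * (σ + y) ≡ r * σ + r * y
  e₄ = solve-∀
  bound : x₀ * σ ≤ (ρ + x) * y
  bound = +-cancelˡ-≤ ((ρ + x) * σ) _ _ (subst₂ _≤_ (e₃ ρ x x₀ σ) (e₄ (ρ + x) σ y) (≮⇒≥ np))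
  s₁ : ∀ x σ y kb δ → x * (σ + y) * (kb * (δ + kb)) ≡ (δ + kb) * x * σ * kb + x * y * kb * (δ + kb)
  s₁ = solve-∀
  s₂ : ∀ x₀ ka σ kb c → x₀ * ka * σ * kb + c ≡ x₀ * σ * (ka * kb) + c
  s₂ = solve-∀
  s₃ : ∀ ρ x y ka kb δ → (ρ + x) * y * (ka * kb) + x * y * kb * (δ + kb) ≡ y * (x * kb * (δ + ka + kb) + ρ * ka * kb)
  s₃ = solve-∀
  s₄ : ∀ ρ y ka kb δ → y * (ρ * δ * (δ + ka + kb) + ρ * ka * kb) ≡ ρ * ((δ + ka) * y) * (δ + kb)
  s₄ = solve-∀
  s₅ : ∀ ρ y₀ kb δ → ρ * (y₀ * kb) * (δ + kb) ≡ ρ * y₀ * (kb * (δ + kb))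
  s₅ = solve-∀
  pos : NonZero (δ + ka + kb)
  pos rewrite +-suc (δ + ka) kb′ = _
  core : x * (σ + y) < ρ * y₀
  core = *-cancelʳ-< (kb * (δ + kb)) _ _ (begin-strict
    x * (σ + y) * (kb * (δ + kb))                   ≡⟨ s₁ x σ y kb δ ⟩
    (δ + kb) * x * σ * kb + x * y * kb * (δ + kb)   ≡⟨ cong (λ w → w * σ * kb + x * y * kb * (δ + kb)) (sym hx) ⟩
    x₀ * ka * σ * kb + x * y * kb * (δ + kb)        ≡⟨ s₂ x₀ ka σ kb (x * y * kb * (δ + kb)) ⟩
    x₀ * σ * (ka * kb) + x * y * kb * (δ + kb)      ≤⟨ +-monoˡ-≤ _ (*-monoˡ-≤ (ka * kb) bound) ⟩
    (ρ + x) * y * (ka * kb) + x * y * kb * (δ + kb) ≡⟨ s₃ ρ x y ka kb δ ⟩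
    y * (x * kb * (δ + ka + kb) + ρ * ka * kb)      <⟨ *-monoʳ-< y (+-monoˡ-< (ρ * ka * kb) (*-monoˡ-< (δ + ka + kb) {{pos}} small)) ⟩
    y * (ρ * δ * (δ + ka + kb) + ρ * ka * kb)       ≡⟨ s₄ ρ y ka kb δ ⟩
    ρ * ((δ + ka) * y) * (δ + kb)                   ≡⟨ cong (λ w → ρ * w * (δ + kb)) (sym hy) ⟩
    ρ * (y₀ * kb) * (δ + kb)                        ≡⟨ s₅ ρ y₀ kb δ ⟩
    ρ * y₀ * (kb * (δ + kb)) ∎)
    where open ≤-Reasoning

truncate discard : ∀ {u} → ℕ → Fam (suc u) → Fam (suc u)
truncate e = move e (const true)
discard e = move e (const false)

∂ : ∀ {u} → Fam (suc u) → ℕ → ℕ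
∂ f e = # (boundary f (const true)) e

discard-W : ∀ {u} N k e (f : Fam (suc u)) → W N k f ≡ W N k (discard e f) + ∂ f e * wt N k (suc e)
discard-W {u} N k e f = sym (trans (move-W N k e (const false) f)
  (trans (cong (λ c → W N k f + c * wt N k e) (∑-zero {φ = λ E → ⟦ boundary f (const false) E ∧ level e E ⟧} (λ _ → refl))) (+-identityʳ _)))

truncate-W : ∀ {u} N k e (f : Fam (suc u)) → W N k (truncate e f) ≡ W N k f + ∂ f e * wt N k e
truncate-W N k e f = trans (sym (trans (cong (λ c → W N k (truncate e f) + c * wt N k (suc e))
  (∑-zero {φ = λ E → ⟦ boundary f (const false) E ∧ level e E ⟧} (λ _ → refl))) (+-identityʳ _))) (move-W N k e (const true) f)

∂≤# : ∀ {u} (f : Fam (suc u)) e → ∂ f e ≤ # (f ↾ inside) e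
∂≤# f e = ∑-mono (λ E → ⟦⟧-mono (λ p → let q , l = ∧-split {f (inside ∷ E) ∧ not (f (outside ∷ E))} p in
                   ∧-pair (proj₁ (∧-split {f (inside ∷ E)} q)) l))

-- The (e+1)-sets and the e-sets of f ↾ outside survive the discarding.
discard-W-bound : ∀ {u} N k e (f : Fam (suc u)) →
  # (f ↾ outside) (suc e) * wt N k (suc e) + # (f ↾ outside) e * wt N k e ≤ W N k (discard e f)
discard-W-bound N k e f = begin
  # f₀ (suc e) * wt N k (suc e) + # f₀ e * wt N k e
    ≡⟨ cong₂ _+_ (sym (∑-* (λ E → ⟦ f₀ E ∧ level (suc e) E ⟧) _)) (sym (∑-* (λ E → ⟦ f₀ E ∧ level e E ⟧) _)) ⟩
  ∑ (λ E → ⟦ f₀ E ∧ level (suc e) E ⟧ * wt N k (suc e)) + ∑ (λ E → ⟦ f₀ E ∧ level e E ⟧ * wt N k e)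
    ≡⟨ sym (∑-+ (λ E → ⟦ f₀ E ∧ level (suc e) E ⟧ * wt N k (suc e)) _) ⟩
  ∑ (λ E → ⟦ f₀ E ∧ level (suc e) E ⟧ * wt N k (suc e) + ⟦ f₀ E ∧ level e E ⟧ * wt N k e)
    ≤⟨ ∑-mono pointwise ⟩
  ∑ (λ E → ⟦ discard e f (outside ∷ E) ⟧ * wt N k ∣ E ∣)
    ≤⟨ m≤m+n _ _ ⟩
  W N k (discard e f) ∎
  where
  open ≤-Reasoning
  f₀ = f ↾ outside
  pointwise : ∀ E → ⟦ f₀ E ∧ level (suc e) E ⟧ * wt N k (suc e) + ⟦ f₀ E ∧ level e E ⟧ * wt N k e
                  ≤ ⟦ discard e f (outside ∷ E) ⟧ * wt N k ∣ E ∣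
  pointwise E with f₀ E
  ... | false = z≤n
  ... | true with level (suc e) E in eq₁ | level e E in eq₂
  ...   | false | false = z≤n
  ...   | true  | false rewrite ≡ᵇ-sound ∣ E ∣ _ eq₁ = ≤-reflexive (+-identityʳ _)
  ...   | false | true  rewrite ≡ᵇ-sound ∣ E ∣ _ eq₂ = ≤-refl
  ...   | true  | true  = contradiction (trans (sym (≡ᵇ-sound ∣ E ∣ _ eq₁)) (≡ᵇ-sound ∣ E ∣ _ eq₂)) 1+n≢n

_⊑[_,_]_ : ∀ {s} → Fam s → ℕ → ℕ → Fam s → Set
f ⊑[ N , k ] g = ∀ X → f X ≡ true → 0 < wt N k ∣ X ∣ → g X ≡ true

truncate-⊒ : ∀ {u} N k e (f : Fam (suc u)) → f ⊑[ N , k ] truncate e f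
truncate-⊒ N k e f (false ∷ E) p _ = ∨-inl p
truncate-⊒ N k e f (true ∷ E) p _ = ∧-pair p (∨-inr {a = f (outside ∷ E)} (∨-inr {a = not (level e E)} refl))

discard-⊒ : ∀ {u} N k e (f : Fam (suc u)) → ∂ f e * wt N k (suc e) ≡ 0 → f ⊑[ N , k ] discard e f
discard-⊒ N k e f z (false ∷ E) p _ = ∨-inl p
discard-⊒ N k e f z (true ∷ E) p w with f (outside ∷ E) in eq₀ | level e E in eq
... | true | _ = ∧-pair p refl
... | false | false = ∧-pair p refl
... | false | true with m*n≡0⇒m≡0∨n≡0 (∂ f e) z
...   | inj₁ ∂0 = ⊥-elim (#≡0⇒ (boundary f (const true)) ∂0 E (≡ᵇ-sound ∣ E ∣ e eq) (∧-pair p (cong not eq₀)))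
...   | inj₂ w0 = contradiction (subst (λ s → 0 < wt N k (suc s)) (≡ᵇ-sound ∣ E ∣ e eq) w) (λ q → <-irrefl (sym w0) q)

module _ (t N k M : ℕ) where

  -- Only members of positive weight, i.e. traces of k-sets, are constrained.
  Concentrated : ∀ {s} → Fam s → Fam s → Set
  Concentrated {s} f g = ∃[ r ] Σ (Subset s) λ U → r ≤ 1 × ∣ U ∣ ≡ t + (r + r) ×
    (∀ X → f X ≡ true → 0 < wt N k ∣ X ∣ → t + r ≤ ∣ X ∩ U ∣) ×
    (∀ X → g X ≡ true → 0 < wt N k ∣ X ∣ → t + r ≤ ∣ X ∩ U ∣)

  -- The claim that the descent carries. That equality fills the threshold family, and is not merely
  -- contained in it, follows only at the end, by counting.
  Bounded : ∀ {s} → Fam s → Fam s → Set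
  Bounded f g = W N k f * W N k g ≤ M × (W N k f * W N k g < M ⊎ Concentrated f g)

  Bounded-sym : ∀ {s} {f g : Fam s} → Bounded f g → Bounded g f
  Bounded-sym {f = f} {g} (le , r) rewrite *-comm (W N k f) (W N k g) =
    le , [ inj₁ , (λ { (r , U , r≤ , U≡ , a , b) → inj₂ (r , U , r≤ , U≡ , b , a) }) ]′ r

  Bounded-< : ∀ {s} {f g f' g' : Fam s} → W N k f * W N k g < W N k f' * W N k g' → Bounded f' g' → Bounded f g
  Bounded-< p (le , _) = <⇒≤ q , inj₁ q where q = <-≤-trans p le

  Bounded-⊑ : ∀ {s} {f g f' g' : Fam s} → W N k f * W N k g ≤ W N k f' * W N k g' →
              f ⊑[ N , k ] f' → g ⊑[ N , k ] g' → Bounded f' g' → Bounded f g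
  Bounded-⊑ p i j (le , inj₁ lt) = ≤-trans p le , inj₁ (≤-<-trans p lt)
  Bounded-⊑ p i j (le , inj₂ (r , U , r≤ , U≡ , a , b)) = ≤-trans p le ,
    inj₂ (r , U , r≤ , U≡ , (λ X q w → a X (i X q w) w) , (λ X q w → b X (j X q w) w))

Add-exists : ∀ {n} (E : Subset n) → ∣ E ∣ < n → ∃[ G ] Add E G
Add-exists (false ∷ E) p = true ∷ E , here
Add-exists (true ∷ E) (s≤s p) = let G , q = Add-exists E p in true ∷ G , there q

-- `inside ∷ E` with E of size e and `outside ∷ G` with G of size e + 1 have the same weight c. So
-- local LYM compares the discarded weight α c with the part γ c of the surviving weight ρ. Here g
-- is e, and h is h' + 1.
scale : ∀ {α γ c ρ δ g h b} → 0 < α * c → α * b ≤ γ * suc g → γ * c ≤ ρ → suc g * h < b * δ → α * c * h < ρ * δ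
scale {α} {γ} {c} {ρ} {δ} {g} {h} {b} pos αγ γρ gap = *-cancelˡ-< (suc g) _ _ (begin-strict
  suc g * (α * c * h) ≡⟨ e₁ (suc g) (α * c) h ⟩
  α * c * (suc g * h) <⟨ *-monoʳ-< (α * c) {{>-nonZero pos}} gap ⟩
  α * c * (b * δ) ≡⟨ e₂ α c b δ ⟩
  α * b * (c * δ) ≤⟨ *-monoˡ-≤ (c * δ) αγ ⟩
  γ * suc g * (c * δ) ≡⟨ e₃ γ (suc g) c δ ⟩
  suc g * (γ * c * δ) ≤⟨ *-monoʳ-≤ (suc g) (*-monoˡ-≤ δ γρ) ⟩
  suc g * (ρ * δ) ∎)
  where
  open ≤-Reasoning
  e₁ : ∀ g x h → g * (x * h) ≡ x * (g * h)
  e₁ = solve-∀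
  e₂ : ∀ α c b δ → α * c * (b * δ) ≡ α * b * (c * δ)
  e₂ = solve-∀
  e₃ : ∀ γ g c δ → γ * g * (c * δ) ≡ g * (γ * c * δ)
  e₃ = solve-∀

gap : ∀ {b t₁ κ z g h} → 2 ≤ b → suc g ≤ b * t₁ → κ ≡ b + h → suc g * suc h < b * (t₁ * κ + z)
gap {b} {t₁} {κ} {z} {g} {h} b≥2 le refl = begin-strict
  -- 2 ≤ b gives suc h < b + h = κ, the source of strictness.
  suc g * suc h     <⟨ *-monoʳ-< (suc g) (+-monoˡ-< h b≥2) ⟩
  suc g * (b + h)   ≤⟨ *-monoˡ-≤ (b + h) le ⟩
  b * t₁ * (b + h)  ≡⟨ *-assoc b t₁ _ ⟩
  b * (t₁ * (b + h)) ≤⟨ *-monoʳ-≤ b (m≤m+n _ z) ⟩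
  b * (t₁ * (b + h) + z) ∎
  where open ≤-Reasoning

≤-witness : ∀ {m n} → m ≤ n → ∃[ d ] n ≡ m + d
≤-witness p = let d , eq = m≤n⇒∃[o]m+o≡n p in d , sym eq

≤-by : ∀ {m n} d → n ≡ m + d → m ≤ n
≤-by d refl = m≤m+n _ d

-- Equivalent to (b - 1)(t₁ - 1) ≥ 1. The bound 2 ≤ t₁ is t ≥ 3.
sum≤product : ∀ {b t₁} → 2 ≤ b → 2 ≤ t₁ → t₁ + b ≤ b * t₁
sum≤product p q with ≤-witness p | ≤-witness q
... | c , refl | d , refl = ≤-by (c + d + c * d) (e c d)
  where
  e : ∀ c d → (2 + c) * (2 + d) ≡ (2 + d) + (2 + c) + (c + d + c * d)
  e = solve-∀

<-by : ∀ {m n} d → n ≡ m + d → 0 < d → m < n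
<-by {m} d refl p = m<m+n m p

-- For a = b = 1 local LYM is too weak. But [u] has only t₁ + 2 sets of size e, and an e-set in
-- `f ↾ outside` contributes c₀ to ρ. As δ ≥ t₁ κ, the claim comes down to t₁ + 2 < t₁ (t₁ + 1),
-- true from t₁ = 2 on.
size-one : ∀ {t₁ κ z α c₀ c₁ ρ} → 2 ≤ t₁ → 0 < κ → 0 < c₁ → α ≤ suc (suc t₁) → c₀ ≤ ρ →
           c₀ * κ ≡ (t₁ * κ + z + κ) * c₁ → α * c₁ * κ < ρ * (t₁ * κ + z)
size-one {t₁} {κ@(suc _)} {z} {α} {c₀} {c₁@(suc _)} {ρ} t₁≥2 _ _ α≤ c₀≤ r with ≤-witness t₁≥2
... | s , refl = *-cancelʳ-< κ _ _ (begin-strict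
  α * c₁ * κ * κ             ≤⟨ *-monoˡ-≤ κ (*-monoˡ-≤ κ (*-monoˡ-≤ c₁ α≤)) ⟩
  (4 + s) * c₁ * κ * κ       <⟨ <-by _ (e₁ s κ z c₁) z<s ⟩
  ((2 + s) * κ + z + κ) * c₁ * δ ≡⟨ cong (_* δ) (sym r) ⟩
  c₀ * κ * δ                 ≤⟨ *-monoˡ-≤ δ (*-monoˡ-≤ κ c₀≤) ⟩
  ρ * κ * δ                  ≡⟨ e₂ ρ κ δ ⟩
  ρ * δ * κ ∎)
  where
  open ≤-Reasoning
  δ = (2 + s) * κ + z
  e₁ : ∀ s κ z c → ((2 + s) * κ + z + κ) * c * ((2 + s) * κ + z) ≡
       (4 + s) * c * κ * κ + c * ((2 + 4 * s + s * s) * (κ * κ) + (5 + 2 * s) * (κ * z) + z * z)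
  e₁ = solve-∀
  e₂ : ∀ ρ k d → ρ * k * d ≡ ρ * d * k
  e₂ = solve-∀

-- The case t₁ = a = b = 2: u = 6, e = 4 and 15 = C(6, 4), while `α * 2 ≤ γ * 5` is local LYM. One
-- fifth of the left side is bounded by the count, four fifths by local LYM. Here h is κ - 1 and v
-- is 2 + z, so that δ = 2 h + v.
size-two : ∀ {v α γ c₀ c₁ ρ h} → 0 < c₁ → 0 < h → α ≤ 15 → α * 2 ≤ γ * 5 → γ * c₁ + c₀ ≤ ρ →
           c₀ * h ≡ (2 * h + v + h) * c₁ → α * c₁ * h < ρ * (2 * h + v)
size-two {v} {α} {γ} {c₀} {c@(suc _)} {ρ} {h@(suc _)} _ _ α≤ αγ ρ≥ r = *-cancelʳ-< (5 * h) _ _ (begin-strict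
  α * c * h * (5 * h)                                           ≡⟨ e₁ α c h ⟩
  α * (c * (h * h)) + α * 2 * (c * (h * (2 * h)))               ≤⟨ +-mono-≤ (*-monoˡ-≤ _ α≤) (*-monoˡ-≤ _ αγ) ⟩
  15 * (c * (h * h)) + γ * 5 * (c * (h * (2 * h)))              <⟨ <-by _ (e₂ γ c h v) z<s ⟩
  γ * c * δ * (5 * h) + 5 * ((2 * h + v + h) * c * δ)           ≡⟨ cong (λ w → γ * c * δ * (5 * h) + 5 * (w * δ)) (sym r) ⟩
  γ * c * δ * (5 * h) + 5 * (c₀ * h * δ)                        ≡⟨ e₃ (γ * c) c₀ δ h ⟩
  (γ * c + c₀) * δ * (5 * h)                                    ≤⟨ *-monoˡ-≤ (5 * h) (*-monoˡ-≤ δ ρ≥) ⟩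
  ρ * δ * (5 * h) ∎)
  where
  open ≤-Reasoning
  δ = 2 * h + v
  e₁ : ∀ α c h → α * c * h * (5 * h) ≡ α * (c * (h * h)) + α * 2 * (c * (h * (2 * h)))
  e₁ = solve-∀
  e₂ : ∀ γ c h v → γ * c * (2 * h + v) * (5 * h) + 5 * ((2 * h + v + h) * c * (2 * h + v)) ≡
       15 * (c * (h * h)) + γ * 5 * (c * (h * (2 * h))) + (c * (15 * (h * h) + 25 * (h * v) + 5 * (v * v)) + 5 * (γ * c * (h * v)))
  e₂ = solve-∀
  e₃ : ∀ g c₀ d h → g * d * (5 * h) + 5 * (c₀ * h * d) ≡ (g + c₀) * d * (5 * h)
  e₃ = solve-∀

positive-or-zero : ∀ n → n ≡ 0 ⊎ 0 < n
positive-or-zero zero = inj₁ refl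
positive-or-zero (suc n) = inj₂ z<s

product>0 : ∀ m {n} → 0 < m * n → 0 < m × 0 < n
product>0 (suc m) {zero} p = contradiction (subst (0 <_) (*-zeroʳ m) p) λ ()
product>0 (suc m) {suc n} p = z<s , z<s

*-scale : ∀ α c h c' q → c * h ≡ q * c' → α * c * h ≡ q * (α * c')
*-scale α c h c' q r = trans (*-assoc α c h) (trans (cong (α *_) r) (comm α q c'))
  where
  comm : ∀ α q c → α * (q * c) ≡ q * (α * c)
  comm = solve-∀

-- The t₁, κ and z below encode t = t₁ + 1, k − t = κ and n = (t + 1)(k − t + 1) + z.  The
-- families live on the u + 1 smallest elements, and N = n − (u + 1).
module Step (t₁ κ z N M u : ℕ) (t₁≥2 : 2 ≤ t₁) (size : N + suc u ≡ suc (suc t₁) * suc κ + z) where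

  private
    k = t₁ + suc κ
    t = suc t₁
    δ = t₁ * κ + z

  -- This is (h + 1) C(N, h + 1) = (N - h) C(N, h). From N = n - u - 1 and u = a + b + t₁ one gets N
  -- - h = δ + h' + 1, so the ratio for a involves the h' of its partner b.
  ratio : ∀ a b h h' → a + b + t₁ ≡ u → κ ≡ a + h → κ ≡ b + h' →
          wt N k (t₁ + a) * suc h ≡ (δ + suc h') * wt N k (suc (t₁ + a))
  ratio a b h h' eu κa κb = subst₂ (λ x y → x * suc h ≡ (δ + suc h') * y) (sym w₀) (sym w₁) (C-ratio N≡)
    where
    open ≡-Reasoning
    k≡ : k ≡ (t₁ + a) + suc h
    k≡ = trans (cong (λ x → t₁ + suc x) κa) (trans (cong (t₁ +_) (sym (+-suc a h))) (sym (+-assoc t₁ a (suc h))))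
    w₀ : wt N k (t₁ + a) ≡ N C suc h
    w₀ = trans (cong (λ x → wt N x (t₁ + a)) k≡) (wt-+ N (t₁ + a) (suc h))
    w₁ : wt N k (suc (t₁ + a)) ≡ N C h
    w₁ = trans (cong (λ x → wt N x (suc (t₁ + a))) (trans k≡ (+-suc (t₁ + a) h))) (wt-+ N (suc (t₁ + a)) h)
    e₁ : ∀ t κ z → suc (suc t) * suc κ + z ≡ t * κ + z + (κ + κ) + suc (suc t)
    e₁ = solve-∀
    e₂ : ∀ d a h b h' t → d + ((a + h) + (b + h')) + suc (suc t) ≡ h + (d + suc h') + suc (a + b + t)
    e₂ = solve-∀
    N≡ : N ≡ h + (δ + suc h')
    N≡ = +-cancelʳ-≡ (suc u) _ _ (begin
      N + suc u ≡⟨ trans size (e₁ t₁ κ z) ⟩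
      δ + (κ + κ) + suc (suc t₁) ≡⟨ cong (λ x → δ + x + suc (suc t₁)) (cong₂ _+_ κa κb) ⟩
      δ + ((a + h) + (b + h')) + suc (suc t₁) ≡⟨ e₂ δ a h b h' t₁ ⟩
      h + (δ + suc h') + suc (a + b + t₁) ≡⟨ cong (λ x → h + (δ + suc h') + suc x) eu ⟩
      h + (δ + suc h') + suc u ∎)

  remaining : ∀ a → 0 < wt N k (suc (t₁ + a)) → ∃[ h ] κ ≡ a + h
  remaining a p = ≤-witness (+-cancelˡ-≤ (suc t₁) a κ
    (subst (suc t₁ + a ≤_) (+-suc t₁ κ) (wt>0⇒≤ N k (suc (t₁ + a)) p)))

  record State (f g : Fam (suc u)) : Set where
    constructor state
    field
      lcˡ   : LeftCompressed f
      lcʳ   : LeftCompressed g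
      cross : Cross t f g
  open State

  State-sym : ∀ {f g} → State f g → State g f
  State-sym (state a b c) = state b a (Cross-sym c)

  -- By `subˡ` and `subʳ` no new member containing the largest element appears, so sizes resolved
  -- earlier stay resolved.
  record Advance (a : ℕ) (f g : Fam (suc u)) : Set where
    constructor advance
    field
      {f' g'}  : Fam (suc u)
      st       : State f' g'
      subˡ     : ∀ E → f' (inside ∷ E) ≡ true → f (inside ∷ E) ≡ true
      subʳ     : ∀ E → g' (inside ∷ E) ≡ true → g (inside ∷ E) ≡ true
      resolved : Resolved t₁ (t₁ + a) f' g'
      back     : Bounded t N k M f' g' → Bounded t N k M f g

  sizes : ∀ a b → a + b + t₁ ≡ u → (t₁ + a) + (t₁ + b) ≡ u + t₁
  sizes a b eu = trans (e a b t₁) (cong (_+ t₁) eu)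
    where
    e : ∀ a b t → (t + a) + (t + b) ≡ a + b + t + t
    e = solve-∀

  Advance-sym : ∀ {a b f g} → a + b + t₁ ≡ u → Advance b g f → Advance a f g
  Advance-sym {a} {b} eu (advance {f'} {g'} st subˡ subʳ res back) =
    advance (State-sym st) subʳ subˡ res' (Bounded-sym t N k M ∘ back ∘ Bounded-sym t N k M)
    where
    res' : Resolved t₁ (t₁ + a) g' f'
    res' E E' sz p q eq = subst (λ Z → t ≤ ∣ Z ∣) (∩-comm E' E)
      (res E' E (+-cancelˡ-≡ (t₁ + a) _ _ (trans (cong (_+ ∣ E' ∣) (sym sz)) (trans eq (sym (sizes a b eu)))))
        q p (trans (+-comm ∣ E' ∣ _) eq))

  module _ (a b : ℕ) (eu : a + b + t₁ ≡ u) {f g : Fam (suc u)} (st : State f g) where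

    private
      e = t₁ + a
      e' = t₁ + b
      α = ∂ f e
      β = ∂ g e'
      c₀ = wt N k e
      c₁ = wt N k (suc e)
      d₀ = wt N k e'
      d₁ = wt N k (suc e')
      ρ = W N k (discard e f)
      σ = W N k (discard e' g)

    advance-by : ∀ {P Q : Fam u} → LeftCompressed P → LeftCompressed Q → Compatible t₁ f g P Q →
                 (Bounded t N k M (move e P f) (move e' Q g) → Bounded t N k M f g) → Advance a f g
    advance-by lP lQ cp back = advance
      (state (move-LC e lP (lcˡ st)) (move-LC e' lQ (lcʳ st)) (move-cross (lcˡ st) (lcʳ st) (cross st) (sizes a b eu) cp))
      (λ E → proj₁ ∘ ∧-split {f (inside ∷ E)}) (λ E → proj₁ ∘ ∧-split {g (inside ∷ E)})
      (move-resolved (lcˡ st) (cross st) (sizes a b eu) cp) back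

    truncate-discard : (Bounded t N k M (truncate e f) (discard e' g) → Bounded t N k M f g) → Advance a f g
    truncate-discard = advance-by (λ _ _ → refl) (λ _ ()) (λ _ _ _ _ _ ())

    discard-truncate : (Bounded t N k M (discard e f) (truncate e' g) → Bounded t N k M f g) → Advance a f g
    discard-truncate = advance-by (λ _ ()) (λ _ _ → refl) (λ _ _ _ _ ())

    -- Discarding weight zero costs nothing, and truncation in g only adds. The product may stay the
    -- same, so concentration has to be passed back by containment.
    weightless : α * c₁ ≡ 0 → Advance a f g
    weightless x≡0 = discard-truncate (Bounded-⊑ t N k M
      (*-mono-≤ (≤-reflexive (trans (discard-W N k e f) (trans (cong (ρ +_) x≡0) (+-identityʳ ρ))))
                (≤-trans (m≤m+n _ _) (≤-reflexive (sym (truncate-W N k e' g)))))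
      (discard-⊒ N k e f x≡0) (truncate-⊒ N k e' g))

    strict : ∀ h h' → κ ≡ a + h → κ ≡ b + h' → 0 < β * d₁ → α * c₁ * suc h' < ρ * δ → Advance a f g
    strict h h' κa κb y>0 small
      with improve (α * c₁) (α * c₀) (β * d₁) (β * d₀) ρ σ δ (suc h) (suc h')
             (*-scale α c₀ (suc h) c₁ (δ + suc h') (ratio a b h h' eu κa κb))
             (*-scale β d₀ (suc h') d₁ (δ + suc h) (ratio b a h' h (trans (cong (_+ t₁) (+-comm b a)) eu) κb κa))
             z<s y>0 small
    ... | inj₁ lt = truncate-discard (Bounded-< t N k M (subst₂ _<_
            (sym (cong₂ _*_ (discard-W N k e f) (discard-W N k e' g)))
            (cong (_* σ) (sym (trans (truncate-W N k e f) (cong (_+ α * c₀) (discard-W N k e f))))) lt))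
    ... | inj₂ lt = discard-truncate (Bounded-< t N k M (subst₂ _<_
            (sym (cong₂ _*_ (discard-W N k e f) (discard-W N k e' g)))
            (cong (ρ *_) (sym (trans (truncate-W N k e' g) (cong (_+ β * d₀) (discard-W N k e' g))))) lt))

    γ = # (f ↾ outside) (suc e)

    -- A set of size t₁ + a misses b elements of [u]; the largest element can be shifted to each of
    -- them.
    up-shadow : # (f ↾ inside) e * b ≤ γ * suc e
    up-shadow = shadow (f ↾ inside) (f ↾ outside) (trans (comm₃ a b t₁) eu) (LC-add (lcˡ st))
      where
      comm₃ : ∀ a b t → b + (t + a) ≡ a + b + t
      comm₃ = solve-∀

    αb≤γe : α * b ≤ γ * suc e
    αb≤γe = ≤-trans (*-monoˡ-≤ b (∂≤# f e)) up-shadow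

    γc₁≤ρ : γ * c₁ ≤ ρ
    γc₁≤ρ = ≤-trans (m≤m+n _ _) (discard-W-bound N k e f)

    strict-by-gap : 2 ≤ b → suc e ≤ b * t₁ → 0 < α * c₁ → 0 < β * d₁ → Advance a f g
    strict-by-gap b≥2 le x>0 y>0 with remaining a (proj₂ (product>0 α x>0)) | remaining b (proj₂ (product>0 β y>0))
    ... | h , κa | h' , κb = strict h h' κa κb y>0 (scale {α} {γ} {c₁} {ρ} {δ} {e} {suc h'} {b} x>0 αb≤γe γc₁≤ρ (gap {z = z} b≥2 le κb))

-- The balanced case: traces avoiding the second largest element

headless : ∀ {u} → Fam u
-- With `true`, `headless-compatible` would fail for u = 0: `inside ∷ []` meets itself in one
-- element, its tail in none.
headless []      = false
headless (b ∷ _) = not b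

LC-headless : ∀ {u} → LeftCompressed (headless {u})
LC-headless here ()
LC-headless (there p) q = q

-- Shift the largest element of `inside ∷ E` to the free second place. The result shares neither of
-- the top two places with `inside ∷ E'`, so the common elements all lie in E ∩ E'.
headless-compatible : ∀ {u t} {f g : Fam (suc u)} → LeftCompressed f → Cross (suc t) f g →
                      Compatible t f g headless headless
headless-compatible lf cr (false ∷ E) (false ∷ E') p q _ _ = cr (outside ∷ inside ∷ E) (inside ∷ outside ∷ E') (lf here p) q

headless-partition : ∀ {u} (f : Fam (suc u)) e →
  ∂ f e ≡ # (boundary f headless) e + # (boundary f (not ∘ headless)) e
headless-partition f e = trans (∑-cong pointwise) (∑-+ (λ E → ⟦ boundary f headless E ∧ level e E ⟧) _)
  where
  pointwise : ∀ E → ⟦ boundary f (const true) E ∧ level e E ⟧ ≡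
              ⟦ boundary f headless E ∧ level e E ⟧ + ⟦ boundary f (not ∘ headless) E ∧ level e E ⟧
  pointwise E with headless E
  ... | true = sym (+-identityʳ _)
  ... | false = refl

-- If f ↾ outside has no sets of size e, the boundary is the whole of level e of f ↾ inside,
-- and left compression bounds the proportion of its members that contain the head.
headless-majority : ∀ {u} (f : Fam (suc u)) {a} e → LeftCompressed f → a + e ≡ u → # (f ↾ outside) e ≡ 0 →
  # (boundary f (not ∘ headless)) e * a ≤ # (boundary f headless) e * e
headless-majority {zero} f {zero} zero lf eq none = ≤-reflexive (*-zeroʳ (# (boundary f (not ∘ headless)) 0))
headless-majority {suc u} f {a} zero lf eq none = ≤-trans (≤-reflexive (cong (_* a)
  (cong₂ _+_ (∑-zero {u} (λ _ → refl)) (∑-zero {u} (λ E → cong ⟦_⟧ (∧-zeroʳ (f (inside ∷ inside ∷ E) ∧ not (f (outside ∷ inside ∷ E))))))))) z≤n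
headless-majority {zero} f {a} (suc e) lf eq none = contradiction (trans (sym (+-suc a e)) eq) λ ()
headless-majority {suc u} f {a} (suc e) lf eq none = begin
  # (boundary f (not ∘ headless)) (suc e) * a ≤⟨ *-monoˡ-≤ a with-head ⟩
  # (f₁ ↾ inside) e * a ≤⟨ shadow (f₁ ↾ inside) (f₁ ↾ outside) (suc-injective (trans (sym (+-suc a e)) eq)) (LC-add (LC-↾ lf)) ⟩
  # (f₁ ↾ outside) (suc e) * suc e ≤⟨ *-monoˡ-≤ (suc e) without-head ⟩
  # (boundary f headless) (suc e) * suc e ∎
  where
  open ≤-Reasoning
  f₁ = f ↾ inside
  with-head : # (boundary f (not ∘ headless)) (suc e) ≤ # (f₁ ↾ inside) e
  with-head = +-mono-≤ (≤-reflexive (∑-zero {u} (λ _ → refl)))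
    (∑-mono (λ E → ⟦⟧-mono (λ p → let q , l = ∧-split {f₁ (inside ∷ E) ∧ not (f (outside ∷ inside ∷ E))} p in
      ∧-pair (proj₁ (∧-split {f₁ (inside ∷ E)} q)) l)))
  without-head : # (f₁ ↾ outside) (suc e) ≤ # (boundary f headless) (suc e)
  without-head = ≤-trans (∑-mono (λ E → ⟦⟧-mono (λ p → let q , l = ∧-split {f₁ (outside ∷ E)} p in
      ∧-pair (∧-pair q (absent (outside ∷ E) (≡ᵇ-sound ∣ E ∣ _ l))) l))) (m≤m+n _ _)
    where
    absent : ∀ E → ∣ E ∣ ≡ suc e → not (f (outside ∷ E)) ≡ true
    absent E sz with f (outside ∷ E) in eq₀
    ... | false = refl
    ... | true = ⊥-elim (#≡0⇒ (f ↾ outside) none E sz eq₀)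

first-gap : ∀ {t₁ κ z α γ c ρ y y₀ g} → g ≡ suc t₁ → 0 < κ → 0 < α * c → 0 < y → α * 1 ≤ γ * g → γ * c ≤ ρ →
            y₀ * κ ≡ (t₁ * κ + z + suc κ) * y → (ρ + α * c) * (0 + y) < ρ * (0 + y + y₀)
first-gap {t₁} {κ@(suc _)} {z} {α} {zero} {c} refl _ x>0 _ αγ _ _ =
  contradiction (proj₁ (product>0 α x>0)) (<⇒≱ (s≤s (subst (_≤ 0) (*-identityʳ α) αγ)))
first-gap {t₁} {κ@(suc _)} {z} {α} {γ@(suc _)} {c} {ρ} {y@(suc _)} {y₀} refl _ x>0 _ αγ γρ r
  with suc c′ ← c | _ ← proj₂ (product>0 α x>0) = subst₂ _<_ (sym (e₁ ρ (α * suc c′) y)) (sym (e₂ ρ y y₀)) (+-monoʳ-< (ρ * y) core)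
  where
  e₁ : ∀ ρ x y → (ρ + x) * (0 + y) ≡ ρ * y + x * y
  e₁ = solve-∀
  e₂ : ∀ ρ y y₀ → ρ * (0 + y + y₀) ≡ ρ * y + ρ * y₀
  e₂ = solve-∀
  e₃ : ∀ α c y κ → α * c * y * κ ≡ α * 1 * (c * y * κ)
  e₃ = solve-∀
  e₄ : ∀ γ t₁ c y κ z → γ * c * ((t₁ * κ + z + suc κ) * y) ≡ γ * suc t₁ * (c * y * κ) + γ * c * y * suc z
  e₄ = solve-∀
  core : α * suc c′ * y < ρ * y₀
  core = *-cancelʳ-< κ _ _ (begin-strict
    α * suc c′ * y * κ ≡⟨ e₃ α (suc c′) y κ ⟩
    α * 1 * (suc c′ * y * κ) ≤⟨ *-monoˡ-≤ _ αγ ⟩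
    γ * suc t₁ * (suc c′ * y * κ) <⟨ <-by _ (e₄ γ t₁ (suc c′) y κ z) z<s ⟩
    γ * suc c′ * ((t₁ * κ + z + suc κ) * y) ≡⟨ cong (γ * suc c′ *_) (sym r) ⟩
    γ * suc c′ * (y₀ * κ) ≤⟨ *-monoˡ-≤ (y₀ * κ) γρ ⟩
    ρ * (y₀ * κ) ≡⟨ sym (*-assoc ρ y₀ κ) ⟩
    ρ * y₀ * κ ∎)
    where open ≤-Reasoning

majority>0 : ∀ h₀ h₁ {a m} → 0 < a → h₁ * a ≤ h₀ * m → 0 < h₀ + h₁ → 0 < h₀
majority>0 (suc h₀) h₁ _ _ _ = z<s
majority>0 zero (suc h₁) {a} a>0 maj _ = contradiction a>0 (<⇒≱ (s≤s (≤-trans (m≤m+n a (h₁ * a)) maj)))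

module _ {t₁ κ z a h h₀ h₁ c₀ c₁ : ℕ} (t₁≥2 : 2 ≤ t₁) (κa : κ ≡ a + h) (a>0 : 0 < a) (r : c₀ * suc h ≡ (t₁ * κ + z + suc h) * c₁)
         (maj : h₁ * a ≤ h₀ * (t₁ + a)) where

  private
    δ = t₁ * κ + z
    open ≤-Reasoning
    e₁ : ∀ h₁ c₁ a s → h₁ * c₁ * (a * s) ≡ h₁ * a * (c₁ * s)
    e₁ = solve-∀
    e₂ : ∀ h₀ t a s c₁ → h₀ * (t + a) * (c₁ * s) ≡ h₀ * c₁ * (t * s) + h₀ * c₁ * (a * s)
    e₂ = solve-∀
    e₃ : ∀ h₀ c₁ a δ s → h₀ * c₁ * (a * δ) + h₀ * c₁ * (a * s) ≡ h₀ * a * ((δ + s) * c₁)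
    e₃ = solve-∀
    e₄ : ∀ h₀ a c₀ s → h₀ * a * (c₀ * s) ≡ h₀ * c₀ * (a * s)
    e₄ = solve-∀
    prefix : h₁ * c₁ * (a * suc h) ≤ h₀ * c₁ * (t₁ * suc h) + h₀ * c₁ * (a * suc h)
    prefix = begin
      h₁ * c₁ * (a * suc h) ≡⟨ e₁ h₁ c₁ a (suc h) ⟩
      h₁ * a * (c₁ * suc h) ≤⟨ *-monoˡ-≤ (c₁ * suc h) maj ⟩
      h₀ * (t₁ + a) * (c₁ * suc h) ≡⟨ e₂ h₀ t₁ a (suc h) c₁ ⟩
      h₀ * c₁ * (t₁ * suc h) + h₀ * c₁ * (a * suc h) ∎
    suffix : h₀ * c₁ * (a * δ) + h₀ * c₁ * (a * suc h) ≡ h₀ * c₀ * (a * suc h)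
    suffix = trans (e₃ h₀ c₁ a δ (suc h)) (trans (cong (h₀ * a *_) (sym r)) (e₄ h₀ a c₀ (suc h)))
    h<κ : suc h ≤ κ
    h<κ = ≤-trans (+-monoˡ-≤ h a>0) (≤-reflexive (sym κa))
    pull : ∀ {m n} → m ≤ n → h₀ * c₁ * m + h₀ * c₁ * (a * suc h) ≤ h₀ * c₁ * n + h₀ * c₁ * (a * suc h)
    pull p = +-monoˡ-≤ (h₀ * c₁ * (a * suc h)) (*-monoʳ-≤ (h₀ * c₁) p)
    a*s : NonZero (a * suc h)
    a*s = m*n≢0 a (suc h) {{>-nonZero a>0}}

  -- Majority and weight ratio reduce this to t₁ (h + 1) ≤ a δ. It holds since h + 1 ≤ κ, and is
  -- tight only for a = 1 and z = 0, that is, n = (t + 1)(k - t + 1).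
  headless-gain : h₁ * c₁ ≤ h₀ * c₀
  headless-gain = *-cancelʳ-≤ _ _ (a * suc h) {{a*s}} (≤-trans prefix (≤-trans (pull t₁h≤aδ) (≤-reflexive suffix)))
    where
    t₁h≤aδ : t₁ * suc h ≤ a * δ
    t₁h≤aδ = ≤-trans (*-monoʳ-≤ t₁ h<κ) (≤-trans (m≤m+n (t₁ * κ) z) (m≤n*m δ a {{>-nonZero a>0}}))

  headless-strict-gain : 2 ≤ a → 0 < h₀ + h₁ → 0 < c₁ → h₁ * c₁ < h₀ * c₀
  headless-strict-gain a≥2 h>0 c₁>0 = *-cancelʳ-< (a * suc h) _ _ (≤-<-trans prefix (<-≤-trans
    (+-monoˡ-< (h₀ * c₁ * (a * suc h)) (*-monoʳ-< (h₀ * c₁) {{m*n≢0 h₀ c₁ {{>-nonZero h₀>0}} {{>-nonZero c₁>0}}}} t₁h<aδ)) (≤-reflexive suffix)))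
    where
    t₁κ>0 : 0 < t₁ * κ
    t₁κ>0 = *-mono-≤ (≤-trans (s≤s z≤n) t₁≥2) (≤-trans (s≤s z≤n) h<κ)
    t₁h<aδ : t₁ * suc h < a * δ
    t₁h<aδ = begin-strict
      t₁ * suc h ≤⟨ *-monoʳ-≤ t₁ h<κ ⟩
      t₁ * κ <⟨ m<m+n (t₁ * κ) t₁κ>0 ⟩
      t₁ * κ + t₁ * κ ≡⟨ cong (t₁ * κ +_) (sym (+-identityʳ _)) ⟩
      2 * (t₁ * κ) ≤⟨ *-mono-≤ a≥2 (m≤m+n (t₁ * κ) z) ⟩
      a * δ ∎
    h₀>0 : 0 < h₀
    h₀>0 = majority>0 h₀ h₁ a>0 maj h>0

bool-cases : ∀ b → (b ≡ true → ⊥) → b ≡ false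
bool-cases false _ = refl
bool-cases true h = ⊥-elim (h refl)

W-empty : ∀ {s} N k (f : Fam s) → (∀ X → f X ≡ true → ⊥) → W N k f ≡ 0
W-empty N k f h = ∑-zero (λ X → cong (λ b → ⟦ b ⟧ * wt N k ∣ X ∣) (bool-cases (f X) (h X)))

sum<product : ∀ {t₁} c → 2 ≤ t₁ → t₁ + (3 + c) < (3 + c) * t₁
sum<product c p with ≤-witness p
... | s , refl = ≤-by (s + s + c + c * s) (e c s)
  where
  e : ∀ c s → (3 + c) * (2 + s) ≡ suc ((2 + s) + (3 + c)) + (s + s + c + c * s)
  e = solve-∀

-- The conflicts of each size

module AllSteps (t₁ κ z N M u : ℕ) (t₁≥2 : 2 ≤ t₁) (size : N + suc u ≡ suc (suc t₁) * suc κ + z) where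

  open Step t₁ κ z N M u t₁≥2 size public
  open State

  private
    k = t₁ + suc κ
    t = suc t₁
    δ = t₁ * κ + z

  module _ (eu : 0 + 1 + t₁ ≡ u) {f g : Fam (suc u)} (st : State f g) where

    private
      e = t₁ + 0
      e' = t₁ + 1
      α = ∂ f e
      β = ∂ g e'

    -- `inside ∷ E` has size t, so every member of g contains it, and in particular the largest
    -- element. Shifted off the largest element it becomes [u], so g contains at most the full set,
    -- and this is discarded.
    discard-exhausts : 0 < α → ∀ X → discard e' g X ≡ true → ⊥
    discard-exhausts α>0 with #>0⇒∃ (boundary f (const true)) α>0
    ... | E , p , sz with ∧-split {f (inside ∷ E)} p
    ... | fE , _ with Add-exists E (subst₂ _<_ (sym (trans sz (+-identityʳ t₁))) eu (n<1+n t₁))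
    ... | G , ad = go
      where
      small : ∣ E ∣ ≡ t₁
      small = trans sz (+-identityʳ t₁)
      top : ∀ Y → g (outside ∷ Y) ≡ true → ⊥
      top Y q = <-irrefl refl (≤-trans (cross st (inside ∷ E) (outside ∷ Y) fE q)
        (≤-trans (∣p∩q∣≤∣p∣ E Y) (≤-reflexive small)))
      go : ∀ X → discard e' g X ≡ true → ⊥
      go (false ∷ Y) q with ∨-split {g (outside ∷ Y)} q
      ... | inj₁ q₀ = top Y q₀
      ... | inj₂ q₁ with () ← proj₂ (∧-split {level e' Y} (proj₂ (∧-split {g (inside ∷ Y)} q₁)))
      go (true ∷ Y) q with ∧-split {g (inside ∷ Y)} q
      ... | q₁ , r with ∨-split {g (outside ∷ Y)} r
      ...   | inj₁ q₀ = top Y q₀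
      ...   | inj₂ r' with ∨-split {not (level e' Y)} r'
      ...     | inj₁ nl = not-true nl (level-true Y (≤-antisym
                  (≤-trans (∣p∣≤n Y) (≤-reflexive (trans (sym eu) (+-comm 1 t₁))))
                  (≤-trans (≤-reflexive (+-comm t₁ 1)) (≤-trans (cross st (outside ∷ G) (inside ∷ Y) (LC-add (lcˡ st) ad fE) q₁) (∣p∩q∣≤∣q∣ G Y)))))

    first-step : 0 < α * wt N k (suc e) → 0 < β * wt N k (suc e') → Advance 0 f g
    first-step x>0 y>0 with remaining 1 (proj₂ (product>0 β y>0))
    ... | h' , κb = discard-truncate 0 1 eu st (Bounded-< t N k M (subst₂ _<_
            (sym (cong₂ _*_ (discard-W N k e f) g≡))
            (cong (W N k (discard e f) *_) (sym (trans (truncate-W N k e' g) (cong (_+ β * wt N k e') g≡)))) lt))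
      where
      g≡ : W N k g ≡ 0 + β * wt N k (suc e')
      g≡ = trans (discard-W N k e' g) (cong (_+ β * wt N k (suc e'))
             (W-empty N k (discard e' g) (discard-exhausts (proj₁ (product>0 α x>0)))))
      rt : wt N k e' * κ ≡ (δ + suc κ) * wt N k (suc e')
      rt = subst (λ x → wt N k e' * x ≡ (δ + suc κ) * wt N k (suc e')) (sym κb) (ratio 1 0 h' κ eu κb refl)
      lt = first-gap {t₁} {κ} {z} {α} {γ 0 1 eu st} {wt N k (suc e)} {W N k (discard e f)} (cong suc (+-identityʳ t₁))
             (subst (0 <_) (sym κb) z<s) x>0 y>0 (αb≤γe 0 1 eu st) (γc₁≤ρ 0 1 eu st)
             (*-scale β (wt N k e') κ (wt N k (suc e')) (δ + suc κ) rt)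

  -- An e-set in `f ↾ outside` survives the discarding and adds c₀ to ρ, which helps where local LYM
  -- is too weak: for a = 1, and for a = 2 with t₁ = 2.
  strict-balanced : ∀ a → 1 ≤ a → a + a + t₁ ≡ u → ∀ {f g} → State f g →
    0 < # (f ↾ outside) (t₁ + a) → 0 < ∂ f (t₁ + a) * wt N k (suc (t₁ + a)) →
    0 < ∂ g (t₁ + a) * wt N k (suc (t₁ + a)) → Advance a f g
  strict-balanced 1 _ eu {f} {g} st ℓ>0 x>0 y>0 with remaining 1 (proj₂ (product>0 (∂ f (t₁ + 1)) x>0))
  ... | h , κa = strict 1 1 eu st h h κa κa y>0 (subst (λ w → ∂ f e * c₁ * w < W N k (discard e f) * δ) κa
        (size-one {z = z} t₁≥2 (subst (0 <_) (sym κa) z<s) (proj₂ (product>0 (∂ f e) x>0)) few c₀≤ρ rt))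
    where
    e = t₁ + 1
    c₁ = wt N k (suc e)
    few : ∂ f e ≤ suc (suc t₁)
    few = ≤-trans (∂≤# f e) (≤-trans (#≤C (f ↾ inside) e) (≤-reflexive
      (trans (cong₂ _C_ (sym eu) (+-comm t₁ 1)) ([1+n]Cn≡1+n (suc t₁)))))
    c₀≤ρ : wt N k e ≤ W N k (discard e f)
    c₀≤ρ = ≤-trans (m≤n*m (wt N k e) (# (f ↾ outside) e) {{>-nonZero ℓ>0}}) (≤-trans (m≤n+m _ _) (discard-W-bound N k e f))
    rt : wt N k e * κ ≡ (δ + κ) * c₁
    rt = subst (λ w → wt N k e * w ≡ (δ + w) * c₁) (sym κa) (ratio 1 1 h h eu κa κa)
  strict-balanced 2 _ eu {f} {g} st ℓ>0 x>0 y>0 with t₁ ≟ 2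
  ... | no t₁≢2 = strict-by-gap 2 2 eu st ≤-refl (subst (_≤ 2 * t₁) (cong suc (+-comm 2 t₁))
        (≤-trans (+-monoˡ-≤ t₁ (≤∧≢⇒< t₁≥2 (t₁≢2 ∘ sym))) (≤-reflexive (cong (t₁ +_) (sym (+-identityʳ t₁)))))) x>0 y>0
  ... | yes t₁≡2 with remaining 2 (proj₂ (product>0 (∂ f (t₁ + 2)) x>0))
  ... | h , κa = strict 2 2 eu st h h κa κa y>0 (subst (λ w → ∂ f e * c₁ * suc h < W N k (discard e f) * w) (sym δ≡)
        (size-two {2 + z} {∂ f e} {# (f ↾ outside) (suc e)} {wt N k e} {h = suc h} (proj₂ (product>0 (∂ f e) x>0)) z<s few
          (subst (λ w → ∂ f e * 2 ≤ # (f ↾ outside) (suc e) * suc w) (cong (_+ 2) t₁≡2) (αb≤γe 2 2 eu st)) ρ≥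
          (trans (ratio 2 2 h h eu κa κa) (cong (λ w → (w + suc h) * c₁) δ≡))))
    where
    e = t₁ + 2
    c₁ = wt N k (suc e)
    few : ∂ f e ≤ 15
    few = ≤-trans (∂≤# f e) (≤-trans (#≤C (f ↾ inside) e) (≤-reflexive
      (cong₂ _C_ (trans (sym eu) (cong (4 +_) t₁≡2)) (cong (_+ 2) t₁≡2))))
    ρ≥ : # (f ↾ outside) (suc e) * c₁ + wt N k e ≤ W N k (discard e f)
    ρ≥ = ≤-trans (+-monoʳ-≤ _ (m≤n*m (wt N k e) (# (f ↾ outside) e) {{>-nonZero ℓ>0}})) (discard-W-bound N k e f)
    δ≡ : δ ≡ 2 * suc h + (2 + z)
    δ≡ = trans (cong₂ (λ x y → x * y + z) t₁≡2 κa) (lem h z)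
      where
      lem : ∀ h z → 2 * (2 + h) + z ≡ 2 * suc h + (2 + z)
      lem = solve-∀
  strict-balanced a@(suc (suc (suc a'))) _ eu st ℓ>0 x>0 y>0 =
    strict-by-gap a a eu st (s≤s (s≤s z≤n)) (sum<product a' t₁≥2) x>0 y>0

  module _ (a : ℕ) (a≥1 : 1 ≤ a) (eu : a + a + t₁ ≡ u) {f g : Fam (suc u)} (st : State f g)
           (x>0 : 0 < ∂ f (t₁ + a) * wt N k (suc (t₁ + a))) (none : # (f ↾ outside) (t₁ + a) ≡ 0) where

    private
      e = t₁ + a
      c₀ = wt N k e
      c₁ = wt N k (suc e)
      h₀ = # (boundary f headless) e
      h₁ = # (boundary f (not ∘ headless)) e

      c₁>0 : 0 < c₁
      c₁>0 = proj₂ (product>0 (∂ f e) x>0)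

      maj : h₁ * a ≤ h₀ * e
      maj = headless-majority f e (lcˡ st) (trans (e₁ a t₁) eu) none
        where
        e₁ : ∀ a t → a + (t + a) ≡ a + a + t
        e₁ = solve-∀

    headless-W-mono : W N k f ≤ W N k (move e headless f)
    headless-W-mono with remaining a c₁>0
    ... | h , κa = +-cancelʳ-≤ (h₁ * c₁) _ _ (≤-trans
      (+-monoʳ-≤ (W N k f) (headless-gain {z = z} {h₀ = h₀} {h₁} t₁≥2 κa a≥1 (ratio a a h h eu κa κa) maj))
      (≤-reflexive (sym (move-W N k e headless f))))

    headless-W-strict : 2 ≤ a → W N k f < W N k (move e headless f)
    headless-W-strict a≥2 with remaining a c₁>0
    ... | h , κa = +-cancelʳ-< (h₁ * c₁) _ _ (<-≤-trans
      (+-monoʳ-< (W N k f) (headless-strict-gain {z = z} {h₀ = h₀} {h₁} t₁≥2 κa a≥1 (ratio a a h h eu κa κa) maj a≥2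
        (subst (0 <_) (headless-partition f e) (proj₁ (product>0 (∂ f e) x>0))) c₁>0))
      (≤-reflexive (sym (move-W N k e headless f))))

  -- Here u = t + 1. A boundary trace of g, shifted off the largest element, forces t elements of
  -- [u] into every member of f. A member without the largest element has more, as `f ↾ outside` has
  -- no sets of size t.
  large-members : 1 + 1 + t₁ ≡ u → ∀ {f g} → State f g → # (f ↾ outside) (t₁ + 1) ≡ 0 → 0 < ∂ g (t₁ + 1) →
                  ∀ X → f X ≡ true → suc t ≤ ∣ X ∣
  large-members eu {f} {g} st none β>0 with #>0⇒∃ (boundary g (const true)) β>0
  ... | E , p , sz with ∧-split {g (inside ∷ E)} p
  ... | gE , _ with Add-exists E (subst₂ _<_ (sym (trans sz (+-comm t₁ 1))) eu (n<1+n t))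
  ... | G , ad = go
    where
    trace : ∀ b Y → f (b ∷ Y) ≡ true → t ≤ ∣ Y ∣
    trace false Y q = ≤-trans (cross st (outside ∷ Y) (outside ∷ G) q (LC-add (lcʳ st) ad gE)) (∣p∩q∣≤∣p∣ Y G)
    trace true Y q = ≤-trans (cross st (inside ∷ Y) (outside ∷ G) q (LC-add (lcʳ st) ad gE)) (∣p∩q∣≤∣p∣ Y G)
    go : ∀ X → f X ≡ true → suc t ≤ ∣ X ∣
    go (true ∷ Y) q = s≤s (trace true Y q)
    go (false ∷ Y) q = ≤∧≢⇒< (trace false Y q) λ t≡ → #≡0⇒ (f ↾ outside) none Y (trans (sym t≡) (+-comm 1 t₁)) q

  headless-step : ∀ a → 1 ≤ a → a + a + t₁ ≡ u → ∀ {f g} → State f g →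
    # (f ↾ outside) (t₁ + a) ≡ 0 → # (g ↾ outside) (t₁ + a) ≡ 0 →
    0 < ∂ f (t₁ + a) * wt N k (suc (t₁ + a)) → 0 < ∂ g (t₁ + a) * wt N k (suc (t₁ + a)) → Advance a f g
  headless-step a a≥1 eu {f} {g} st nf ng x>0 y>0 =
    advance-by a a eu st LC-headless LC-headless (headless-compatible (lcˡ st) (cross st)) (back a≥1 eu nf ng x>0 y>0)
    where
    W>0 : ∀ e (h : Fam (suc u)) → 0 < ∂ h e * wt N k (suc e) → 0 < W N k h
    W>0 e h p = ≤-trans p (≤-trans (m≤n+m _ (W N k (discard e h))) (≤-reflexive (sym (discard-W N k e h))))
    back : ∀ {a} → 1 ≤ a → a + a + t₁ ≡ u → # (f ↾ outside) (t₁ + a) ≡ 0 → # (g ↾ outside) (t₁ + a) ≡ 0 →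
      0 < ∂ f (t₁ + a) * wt N k (suc (t₁ + a)) → 0 < ∂ g (t₁ + a) * wt N k (suc (t₁ + a)) →
      Bounded t N k M (move (t₁ + a) headless f) (move (t₁ + a) headless g) → Bounded t N k M f g
    back {1} _ eu nf ng x>0 y>0 (le , _) =
      ≤-trans (*-mono-≤ (headless-W-mono 1 ≤-refl eu st x>0 nf) (headless-W-mono 1 ≤-refl eu (State-sym st) y>0 ng)) le ,
      -- A tie is possible, and concentration of the moved pair would say nothing about f and g. But
      -- [u + 1] has t + 2 elements and all members of f and g at least t + 1: the case r = 1.
      inj₂ (1 , ⊤ , ≤-refl , trans (∣⊤∣≡n (suc u)) (trans (cong suc (sym eu)) (sym (trans (cong suc (+-comm t₁ 2)) refl))) ,
        concentrated st nf y>0 , concentrated (State-sym st) ng x>0)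
      where
      concentrated : ∀ {f g} → State f g → # (f ↾ outside) (t₁ + 1) ≡ 0 → 0 < ∂ g (t₁ + 1) * wt N k (suc (t₁ + 1)) →
        ∀ X → f X ≡ true → 0 < wt N k ∣ X ∣ → t + 1 ≤ ∣ X ∩ ⊤ ∣
      concentrated {g = g} st n p X q _ = subst₂ _≤_ (+-comm 1 t) (cong ∣_∣ (sym (∩-identityʳ X)))
        (large-members eu st n (proj₁ (product>0 (∂ g (t₁ + 1)) p)) X q)
    back {suc (suc a)} a≥1 eu nf ng x>0 y>0 = Bounded-< t N k M (≤-trans
      (*-monoˡ-< (W N k g) {{>-nonZero (W>0 (t₁ + suc (suc a)) g y>0)}} (headless-W-strict (suc (suc a)) a≥1 eu st x>0 nf (s≤s (s≤s z≤n))))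
      (*-monoʳ-≤ (W N k (move (t₁ + suc (suc a)) headless f)) (headless-W-mono (suc (suc a)) a≥1 eu (State-sym st) y>0 ng)))

  strict-unbalanced : ∀ a b → a < b → a + b + t₁ ≡ u → ∀ {f g} → State f g →
    0 < ∂ f (t₁ + a) * wt N k (suc (t₁ + a)) → 0 < ∂ g (t₁ + b) * wt N k (suc (t₁ + b)) → Advance a f g
  strict-unbalanced zero 1 _ eu st x>0 y>0 = first-step eu st x>0 y>0
  strict-unbalanced (suc a) 1 (s≤s ()) eu st x>0 y>0
  strict-unbalanced a b@(suc (suc _)) a<b eu st x>0 y>0 =
    strict-by-gap a b eu st (s≤s (s≤s z≤n))
      (≤-trans (≤-reflexive (sym (+-suc t₁ a))) (≤-trans (+-monoʳ-≤ t₁ a<b) (sum≤product (s≤s (s≤s z≤n)) t₁≥2))) x>0 y>0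

  advance-at : ∀ a b → 1 ≤ a + b → a + b + t₁ ≡ u → ∀ {f g} → State f g → Advance a f g
  advance-at a b ab≥1 eu {f} {g} st
    with positive-or-zero (∂ f (t₁ + a) * wt N k (suc (t₁ + a))) | positive-or-zero (∂ g (t₁ + b) * wt N k (suc (t₁ + b)))
  ... | inj₁ x≡0 | _ = weightless a b eu st x≡0
  ... | inj₂ _ | inj₁ y≡0 = Advance-sym eu (weightless b a (trans (cong (_+ t₁) (+-comm b a)) eu) (State-sym st) y≡0)
  ... | inj₂ x>0 | inj₂ y>0 with <-cmp a b
  ...   | tri< a<b _ _ = strict-unbalanced a b a<b eu st x>0 y>0
  ...   | tri> _ _ b<a = Advance-sym eu (strict-unbalanced b a b<a (trans (cong (_+ t₁) (+-comm b a)) eu) (State-sym st) y>0 x>0)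
  ...   | tri≈ _ refl _ = balanced (half a ab≥1)
    where
    half : ∀ a → 1 ≤ a + a → 1 ≤ a
    half (suc a) _ = s≤s z≤n
    balanced : 1 ≤ a → Advance a f g
    balanced a≥1 with positive-or-zero (# (f ↾ outside) (t₁ + a)) | positive-or-zero (# (g ↾ outside) (t₁ + a))
    ... | inj₂ p | _ = strict-balanced a a≥1 eu st p x>0 y>0
    ... | inj₁ _ | inj₂ p = Advance-sym eu (strict-balanced a a≥1 eu (State-sym st) p y>0 x>0)
    ... | inj₁ p | inj₁ q = headless-step a a≥1 eu st p q x>0 y>0

-- The descent

project : ∀ {u} → Fam (suc u) → Fam u
project f E = f (outside ∷ E) ∨ f (inside ∷ E)

-- By Pascal's rule the weight of E is shared by `outside ∷ E` and `inside ∷ E`; projecting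
-- completes the pair when only one is present.
project-W : ∀ {u} N k (f : Fam (suc u)) → W N k f ≤ W (suc N) k (project f)
project-W N k f = ≤-trans (≤-reflexive (W-split N k f)) (∑-mono pointwise)
  where
  pointwise : ∀ E → ⟦ f (outside ∷ E) ⟧ * wt N k ∣ E ∣ + ⟦ f (inside ∷ E) ⟧ * wt N k (suc ∣ E ∣)
              ≤ ⟦ project f E ⟧ * wt (suc N) k ∣ E ∣
  pointwise E rewrite wt-pascal N k ∣ E ∣ with f (outside ∷ E) | f (inside ∷ E)
  ... | false | false = z≤n
  ... | false | true = ≤-trans (+-monoˡ-≤ 0 (m≤n+m (wt N k (suc ∣ E ∣)) (wt N k ∣ E ∣))) ≤-refl
  ... | true | false = +-mono-≤ (≤-trans (≤-reflexive (+-identityʳ _)) (m≤m+n (wt N k ∣ E ∣) _)) z≤n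
  ... | true | true = ≤-reflexive (e (wt N k ∣ E ∣) (wt N k (suc ∣ E ∣)))
    where
    e : ∀ x y → 1 * x + 1 * y ≡ 1 * (x + y)
    e = solve-∀

wt-trace>0 : ∀ N k e → 0 < wt N k (suc e) → 0 < wt (suc N) k e
wt-trace>0 N k e p = ≤-trans p (≤-trans (m≤n+m _ (wt N k e)) (≤-reflexive (sym (wt-pascal N k e))))

wt-suc>0 : ∀ N k e → 0 < wt N k e → 0 < wt (suc N) k e
wt-suc>0 N k e p = ≤-trans p (≤-trans (m≤m+n (wt N k e) _) (≤-reflexive (sym (wt-pascal N k e))))

Bounded-project : ∀ {u} t N k M {f g : Fam (suc u)} → Bounded t (suc N) k M (project f) (project g) → Bounded t N k M f g
Bounded-project t N k M {f} {g} (le , alt) = ≤-trans W≤ le , [ (λ lt → inj₁ (≤-<-trans W≤ lt)) , inj₂ ∘ lift ]′ alt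
  where
  W≤ = *-mono-≤ (project-W N k f) (project-W N k g)
  lift-one : ∀ {h : Fam _} {T U} → (∀ X → project h X ≡ true → 0 < wt (suc N) k ∣ X ∣ → T ≤ ∣ X ∩ U ∣) →
             ∀ X → h X ≡ true → 0 < wt N k ∣ X ∣ → T ≤ ∣ X ∩ (outside ∷ U) ∣
  lift-one {h} c (false ∷ E) q w = c E (∨-inl q) (wt-suc>0 N k ∣ E ∣ w)
  lift-one {h} c (true ∷ E) q w = c E (∨-inr {a = h (outside ∷ E)} q) (wt-trace>0 N k ∣ E ∣ w)
  lift : Concentrated t (suc N) k M (project f) (project g) → Concentrated t N k M f g
  lift (r , U , r≤1 , U≡ , cf , cg) = r , outside ∷ U , r≤1 , U≡ , lift-one {f} cf , lift-one {g} cg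

module Descent (t₁ κ z M N₀ : ℕ) (t₁≥2 : 2 ≤ t₁) (size₀ : N₀ + suc t₁ ≡ suc (suc t₁) * suc κ + z)
               (M≡ : M ≡ (N₀ C κ) * (N₀ C κ)) where

  private
    k = t₁ + suc κ
    t = suc t₁

  module _ {f g : Fam t} (cr : Cross t f g) where

    private
      c = wt N₀ k t

      c≡ : c ≡ N₀ C κ
      c≡ = trans (cong (λ x → wt N₀ x t) (+-suc t₁ κ)) (wt-+ N₀ t κ)

      c>0 : 0 < c
      c>0 = subst (0 <_) (sym c≡) (C>0 {N₀} {κ} (+-cancelʳ-≤ t κ N₀ (≤-trans (≤-by _ (e t₁ κ z)) (≤-reflexive (sym size₀)))))
        where
        e : ∀ t₁ κ z → suc (suc t₁) * suc κ + z ≡ κ + suc t₁ + (suc (t₁ * κ + κ + z))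
        e = solve-∀

    large : 0 < W N₀ k g → ∀ X → f X ≡ true → t ≤ ∣ X ∣
    large p X q with ∑>0⇒∃ (λ Y → ⟦ g Y ⟧ * wt N₀ k ∣ Y ∣) p
    ... | Y , r = ≤-trans (cr X Y q (⟦⟧>0 (proj₁ (product>0 ⟦ g Y ⟧ r)))) (∣p∩q∣≤∣p∣ X Y)

    W≤c : 0 < W N₀ k g → W N₀ k f ≤ c
    W≤c p = ≤-trans (∑-mono pointwise) (≤-reflexive (trans (∑-* {t} (λ X → ⟦ level t X ⟧) c)
              (trans (cong (_* c) (trans (#-level t t) (nCn≡1 t))) (*-identityˡ c))))
      where
      pointwise : ∀ X → ⟦ f X ⟧ * wt N₀ k ∣ X ∣ ≤ ⟦ level t X ⟧ * c
      pointwise X with f X in eq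
      ... | false = z≤n
      ... | true with ≤-antisym (∣p∣≤n X) (large p X eq)
      ...   | sz rewrite level-true X sz = ≤-reflexive (cong (λ s → 1 * wt N₀ k s) sz)

    M≡c² : c * c ≡ M
    M≡c² = trans (cong₂ _*_ c≡ c≡) (sym M≡)

    M>0 : 0 < M
    M>0 = subst (0 <_) M≡c² (*-mono-≤ c>0 c>0)

  -- On [t] only the full set can meet another set in t elements. So either a weight vanishes, and M
  -- > 0, or both families consist of [t] alone.
  base : ∀ {f g : Fam t} → Cross t f g → Bounded t N₀ k M f g
  base {f} {g} cr with positive-or-zero (W N₀ k f) | positive-or-zero (W N₀ k g)
  ... | inj₁ Wf≡0 | _ rewrite Wf≡0 = z≤n , inj₁ (M>0 cr)
  ... | inj₂ _ | inj₁ Wg≡0 rewrite Wg≡0 | *-zeroʳ (W N₀ k f) = z≤n , inj₁ (M>0 cr)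
  ... | inj₂ p | inj₂ q = ≤-trans (*-mono-≤ (W≤c cr q) (W≤c (Cross-sym cr) p)) (≤-reflexive (M≡c² cr)) ,
        inj₂ (0 , ⊤ , z≤n , trans (∣⊤∣≡n t) (sym (+-identityʳ t)) , all-of cr q , all-of (Cross-sym cr) p)
    where
    all-of : ∀ {f g} → Cross t f g → 0 < W N₀ k g → ∀ X → f X ≡ true → 0 < wt N₀ k ∣ X ∣ → t + 0 ≤ ∣ X ∩ ⊤ ∣
    all-of cr q X r _ = subst₂ _≤_ (sym (+-identityʳ t)) (cong ∣_∣ (sym (∩-identityʳ X))) (large cr q X r)

  module _ (N m : ℕ) (size : N + suc (m + t) ≡ suc (suc t₁) * suc κ + z) where

    private
      u = m + t
    open AllSteps t₁ κ z N M u t₁≥2 size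

    record Processed (j : ℕ) (f g : Fam (suc u)) : Set where
      field
        {f' g'}  : Fam (suc u)
        st       : State f' g'
        resolved : ∀ a → a < j → Resolved t₁ (t₁ + a) f' g'
        back     : Bounded t N k M f' g' → Bounded t N k M f g

    process : ∀ j → j ≤ suc (suc m) → ∀ {f g} → State f g → Processed j f g
    process zero _ st = record { st = st ; resolved = λ _ () ; back = id }
    process (suc j) (s≤s j≤) st with process j (m≤n⇒m≤1+n j≤) st | ≤-witness j≤
    ... | record { st = st' ; resolved = res ; back = back } | b , eq
      with advance-at j b (subst (1 ≤_) eq (s≤s z≤n)) (trans (cong (_+ t₁) (sym eq)) (sym (+-suc m t₁))) st'
    ...   | advance {f''} {g''} st'' subˡ subʳ res' back' = record { st = st'' ; resolved = resolved ; back = back ∘ back' }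
      where
      resolved : ∀ a → a < suc j → Resolved t₁ (t₁ + a) f'' g''
      resolved a a<j+1 with m≤n⇒m<n∨m≡n (≤-pred a<j+1)
      ... | inj₁ a<j = λ E E' sz p q → res a a<j E E' sz (subˡ E p) (subʳ E' q)
      ... | inj₂ refl = res'

    -- Only two members that both contain the largest element lose one common element. In a conflict
    -- E ∩ E' has size t₁, so E has size t₁ + a with a ≤ m + 1, one of the sizes already resolved.
    project-cross : ∀ {f g} → State f g → (∀ a → a < suc (suc m) → Resolved t₁ (t₁ + a) f g) →
                    Cross t (project f) (project g)
    project-cross {f} {g} (state lf lg cr) res E E' p q with ∨-split {f (outside ∷ E)} p | ∨-split {g (outside ∷ E')} q
    ... | inj₁ p₀ | inj₁ q₀ = cr _ _ p₀ q₀
    ... | inj₁ p₀ | inj₂ q₁ = cr (outside ∷ E) (inside ∷ E') p₀ q₁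
    ... | inj₂ p₁ | inj₁ q₀ = cr (inside ∷ E) (outside ∷ E') p₁ q₀
    ... | inj₂ p₁ | inj₂ q₁ with conflict lf cr E E' p₁ q₁
    ...   | inj₁ le = le
    ...   | inj₂ (sum , int) with ≤-witness (≤-trans (≤-reflexive (sym int)) (∣p∩q∣≤∣p∣ E E'))
    ...     | a , sz = res a a< E E' sz p₁ q₁ sum
      where
      a< : a < suc (suc m)
      a< = s≤s (+-cancelˡ-≤ t₁ a (suc m) (≤-trans (≤-reflexive (sym sz)) (≤-trans (∣p∣≤n E)
             (≤-reflexive (trans (+-suc m t₁) (+-comm (suc m) t₁))))))

    descend : (∀ {f g : Fam u} → LeftCompressed f → LeftCompressed g → Cross t f g → Bounded t (suc N) k M f g) →
              ∀ {f g : Fam (suc u)} → LeftCompressed f → LeftCompressed g → Cross t f g → Bounded t N k M f g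
    descend ih lf lg cr with process (suc (suc m)) ≤-refl (state lf lg cr)
    ... | record { f' = f' ; g' = g' ; st = st ; resolved = res ; back = back } = back (Bounded-project t N k M
      (ih (project-LC f' (State.lcˡ st)) (project-LC g' (State.lcʳ st)) (project-cross st res)))
      where
      project-LC : ∀ (h : Fam (suc u)) → LeftCompressed h → LeftCompressed (project h)
      project-LC h lh = LC-∨ {f = h ↾ outside} (LC-↾ lh) (LC-↾ lh)

  compressed-bound : ∀ m N → N + (m + t) ≡ suc (suc t₁) * suc κ + z → ∀ {f g : Fam (m + t)} →
    LeftCompressed f → LeftCompressed g → Cross t f g → Bounded t N k M f g
  compressed-bound zero N size lf lg cr =
    subst (λ x → Bounded t x k M _ _) (+-cancelʳ-≡ t N₀ N (trans size₀ (sym size))) (base cr)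
  compressed-bound (suc m) N size = descend N m size (compressed-bound m (suc N) (trans (sym (+-suc N (m + t))) size))

-- Shifting

insertPair : ∀ {m} → Fin (suc m) → Bool → Bool → Subset m → Subset (suc (suc m))
insertPair zero a b v = a ∷ b ∷ v
insertPair {suc m} (suc p) a b (c ∷ v) = c ∷ insertPair p a b v

data View {m} (p : Fin (suc m)) : Subset (suc (suc m)) → Set where
  at : ∀ a b v → View p (insertPair p a b v)

view : ∀ {m} (p : Fin (suc m)) X → View p X
view zero (a ∷ b ∷ v) = at a b v
view {suc m} (suc p) (c ∷ X) with view p X
... | at a b v = at a b (c ∷ v)

size-∷ : ∀ {n} b (X : Subset n) → ∣ b ∷ X ∣ ≡ ⟦ b ⟧ + ∣ X ∣
size-∷ false X = refl
size-∷ true X = refl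

+-middle : ∀ x y z → x + (y + z) ≡ y + (x + z)
+-middle = solve-∀

insertPair-size : ∀ {m} (p : Fin (suc m)) a b v → ∣ insertPair p a b v ∣ ≡ ⟦ a ⟧ + ⟦ b ⟧ + ∣ v ∣
insertPair-size zero a b v = trans (size-∷ a (b ∷ v)) (trans (cong (⟦ a ⟧ +_) (size-∷ b v)) (sym (+-assoc ⟦ a ⟧ ⟦ b ⟧ ∣ v ∣)))
insertPair-size {suc m} (suc p) a b (c ∷ v) = trans (size-∷ c (insertPair p a b v)) (trans (cong (⟦ c ⟧ +_) (insertPair-size p a b v))
  (trans (+-middle ⟦ c ⟧ (⟦ a ⟧ + ⟦ b ⟧) ∣ v ∣) (cong (⟦ a ⟧ + ⟦ b ⟧ +_) (sym (size-∷ c v)))))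

insertPair-∩ : ∀ {m} (p : Fin (suc m)) a b v a' b' v' → insertPair p a b v ∩ insertPair p a' b' v' ≡ insertPair p (a ∧ a') (b ∧ b') (v ∩ v')
insertPair-∩ zero a b v a' b' v' = refl
insertPair-∩ {suc m} (suc p) a b (c ∷ v) a' b' (c' ∷ v') = cong (c ∧ c' ∷_) (insertPair-∩ p a b v a' b' v')

insertPair-∩-size : ∀ {m} (p : Fin (suc m)) a b v a' b' v' →
  ∣ insertPair p a b v ∩ insertPair p a' b' v' ∣ ≡ ⟦ a ∧ a' ⟧ + ⟦ b ∧ b' ⟧ + ∣ v ∩ v' ∣
insertPair-∩-size p a b v a' b' v' = trans (cong ∣_∣ (insertPair-∩ p a b v a' b' v')) (insertPair-size p _ _ _)

∑-insertPair : ∀ {m} (p : Fin (suc m)) (φ : Subset (suc (suc m)) → ℕ) → ∑ φ ≡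
  ∑ (λ v → (φ (insertPair p false false v) + φ (insertPair p true true v)) + (φ (insertPair p true false v) + φ (insertPair p false true v)))
∑-insertPair zero φ = sym (begin
  ∑ (λ v → (φ (false ∷ false ∷ v) + φ (true ∷ true ∷ v)) + (φ (true ∷ false ∷ v) + φ (false ∷ true ∷ v)))
    ≡⟨ ∑-+ (λ v → φ (false ∷ false ∷ v) + φ (true ∷ true ∷ v)) _ ⟩
  _ ≡⟨ cong₂ _+_ (∑-+ (λ v → φ (false ∷ false ∷ v)) _) (∑-+ (λ v → φ (true ∷ false ∷ v)) _) ⟩
  _ ≡⟨ e (∑ (λ v → φ (false ∷ false ∷ v))) _ _ _ ⟩
  ∑ φ ∎)
  where
  open ≡-Reasoning
  e : ∀ a b c d → (a + b) + (c + d) ≡ (a + d) + (c + b)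
  e = solve-∀
∑-insertPair {suc m} (suc p) φ = cong₂ _+_ (∑-insertPair p (φ ∘ (outside ∷_))) (∑-insertPair p (φ ∘ (inside ∷_)))

-- The usual shift for two adjacent elements: a set with the larger one stays only if its shifted
-- version is present too.
shift : ∀ {m} → Fin (suc m) → Fam (suc (suc m)) → Fam (suc (suc m))
shift zero f (true ∷ false ∷ v) = f (true ∷ false ∷ v) ∧ f (false ∷ true ∷ v)
shift zero f (false ∷ true ∷ v) = f (true ∷ false ∷ v) ∨ f (false ∷ true ∷ v)
shift zero f (true ∷ true ∷ v) = f (true ∷ true ∷ v)
shift zero f (false ∷ false ∷ v) = f (false ∷ false ∷ v)
shift {suc m} (suc p) f (c ∷ X) = shift p (f ∘ (c ∷_)) X

shift-down : ∀ {m} (f : Fam (suc (suc m))) p v →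
  shift p f (insertPair p true false v) ≡ f (insertPair p true false v) ∧ f (insertPair p false true v)
shift-down f zero v = refl
shift-down {suc m} f (suc p) (c ∷ v) = shift-down (f ∘ (c ∷_)) p v

shift-up : ∀ {m} (f : Fam (suc (suc m))) p v →
  shift p f (insertPair p false true v) ≡ f (insertPair p true false v) ∨ f (insertPair p false true v)
shift-up f zero v = refl
shift-up {suc m} f (suc p) (c ∷ v) = shift-up (f ∘ (c ∷_)) p v

shift-same : ∀ {m} (f : Fam (suc (suc m))) p a v → shift p f (insertPair p a a v) ≡ f (insertPair p a a v)
shift-same f zero true v = refl
shift-same f zero false v = refl
shift-same {suc m} f (suc p) a (c ∷ v) = shift-same (f ∘ (c ∷_)) p a v

card : ∀ {n} → Fam n → ℕ
card f = ∑ (λ X → ⟦ f X ⟧)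

⟦∧⟧+⟦∨⟧ : ∀ a b → ⟦ a ∧ b ⟧ + ⟦ a ∨ b ⟧ ≡ ⟦ a ⟧ + ⟦ b ⟧
⟦∧⟧+⟦∨⟧ false b = refl
⟦∧⟧+⟦∨⟧ true b = +-comm ⟦ b ⟧ 1

shift-card : ∀ {m} p (f : Fam (suc (suc m))) → card (shift p f) ≡ card f
shift-card {m} p f = trans (∑-insertPair p (λ X → ⟦ shift p f X ⟧)) (trans (∑-cong pointwise) (sym (∑-insertPair p (λ X → ⟦ f X ⟧))))
  where
  terms : Fam (suc (suc m)) → Subset m → ℕ
  terms h v = (⟦ h (insertPair p false false v) ⟧ + ⟦ h (insertPair p true true v) ⟧) + (⟦ h (insertPair p true false v) ⟧ + ⟦ h (insertPair p false true v) ⟧)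
  pointwise : ∀ v → terms (shift p f) v ≡ terms f v
  pointwise v rewrite shift-same f p false v | shift-same f p true v | shift-down f p v | shift-up f p v =
    cong (⟦ f (insertPair p false false v) ⟧ + ⟦ f (insertPair p true true v) ⟧ +_) (⟦∧⟧+⟦∨⟧ (f (insertPair p true false v)) (f (insertPair p false true v)))

-- A place counts the places behind it, so an adjacent shift lowers the rank by exactly one.
rank : ∀ {n} → Subset n → ℕ
rank [] = 0
rank {suc n} (b ∷ X) = ⟦ b ⟧ * n + rank X

insertPair-rank : ∀ {m} (p : Fin (suc m)) v → rank (insertPair p true false v) ≡ suc (rank (insertPair p false true v))
insertPair-rank zero v = refl
insertPair-rank {suc m} (suc p) (c ∷ v) = trans (cong (⟦ c ⟧ * suc (suc m) +_) (insertPair-rank p v)) (+-suc _ _)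

μ : ∀ {n} → Fam n → ℕ
μ f = ∑ (λ X → ⟦ f X ⟧ * rank X)

moved : ∀ {m} → Fin (suc m) → Fam (suc (suc m)) → Fam m
moved p f v = f (insertPair p true false v) ∧ not (f (insertPair p false true v))

shift-μ : ∀ {m} p (f : Fam (suc (suc m))) → μ (shift p f) + card (moved p f) ≡ μ f
shift-μ {m} p f = begin
  μ (shift p f) + card (moved p f) ≡⟨ cong (_+ card (moved p f)) (∑-insertPair p (λ X → ⟦ shift p f X ⟧ * rank X)) ⟩
  ∑ (terms (shift p f)) + card (moved p f) ≡⟨ sym (∑-+ (terms (shift p f)) (λ v → ⟦ moved p f v ⟧)) ⟩
  ∑ (λ v → terms (shift p f) v + ⟦ moved p f v ⟧) ≡⟨ ∑-cong pointwise ⟩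
  ∑ (terms f) ≡⟨ sym (∑-insertPair p (λ X → ⟦ f X ⟧ * rank X)) ⟩
  μ f ∎
  where
  open ≡-Reasoning
  terms : Fam (suc (suc m)) → Subset m → ℕ
  terms h v = (⟦ h (insertPair p false false v) ⟧ * rank (insertPair p false false v) + ⟦ h (insertPair p true true v) ⟧ * rank (insertPair p true true v))
            + (⟦ h (insertPair p true false v) ⟧ * rank (insertPair p true false v) + ⟦ h (insertPair p false true v) ⟧ * rank (insertPair p false true v))
  swap : ∀ a b r → ⟦ a ∧ b ⟧ * suc r + ⟦ a ∨ b ⟧ * r + ⟦ a ∧ not b ⟧ ≡ ⟦ a ⟧ * suc r + ⟦ b ⟧ * r
  swap true true r = +-identityʳ _
  swap true false r = e r
    where
    e : ∀ r → r + 0 + 1 ≡ suc (r + 0) + 0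
    e = solve-∀
  swap false b r = +-identityʳ _
  pointwise : ∀ v → terms (shift p f) v + ⟦ moved p f v ⟧ ≡ terms f v
  pointwise v rewrite shift-same f p false v | shift-same f p true v | shift-down f p v | shift-up f p v | insertPair-rank p v =
    trans (+-assoc (⟦ f (insertPair p false false v) ⟧ * rank (insertPair p false false v) + ⟦ f (insertPair p true true v) ⟧ * rank (insertPair p true true v)) _ _)
      (cong (⟦ f (insertPair p false false v) ⟧ * rank (insertPair p false false v) + ⟦ f (insertPair p true true v) ⟧ * rank (insertPair p true true v) +_)
        (swap (f (insertPair p true false v)) (f (insertPair p false true v)) (rank (insertPair p false true v))))

Sw-position : ∀ {m} {X Y : Subset (suc (suc m))} → Sw X Y → ∃[ p ] ∃[ v ] X ≡ insertPair p true false v × Y ≡ insertPair p false true v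
Sw-position here = zero , _ , refl , refl
Sw-position {zero} (there (there ()))
Sw-position {suc m} (there {b = b} s) with Sw-position s
... | p , v , refl , refl = suc p , b ∷ v , refl , refl

unmoved⇒LC : ∀ {m} (f : Fam (suc (suc m))) → (∀ p → card (moved p f) ≡ 0) → LeftCompressed f
unmoved⇒LC f none s q with Sw-position s
... | p , v , refl , refl with f (insertPair p false true v) in eq
...   | true = refl
...   | false = contradiction (subst (_≤ 0) (true⇒⟦⟧≡1 (∧-pair q (cong not eq))) (subst (⟦ moved p f v ⟧ ≤_) (none p) (term≤∑ _ v))) λ ()

-- Both families are shifted at the same place, as cross-intersection demands. The sum of their
-- ranks drops by the number of sets moved; when no place moves anything, both are left compressed.
compression-induction : ∀ {m} (Q : Fam (suc (suc m)) → Fam (suc (suc m)) → Set) →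
  (∀ f g → LeftCompressed f → LeftCompressed g → Q f g) →
  (∀ p f g → Q (shift p f) (shift p g) → Q f g) → ∀ f g → Q f g
compression-induction {m} Q compressed unshift f g = go (suc (μ f + μ g)) f g ≤-refl
  where
  gain : Fin (suc m) → Fam (suc (suc m)) → Fam (suc (suc m)) → ℕ
  gain p f g = card (moved p f) + card (moved p g)
  total : ∀ p f g → (μ (shift p f) + μ (shift p g)) + gain p f g ≡ μ f + μ g
  total p f g = trans (+-interchange (μ (shift p f)) (μ (shift p g)) (card (moved p f)) (card (moved p g)))
    (cong₂ _+_ (shift-μ p f) (shift-μ p g))
  go : ∀ bound f g → μ f + μ g < bound → Q f g
  go (suc bound) f g (s≤s le) with any? (λ p → 0 <? gain p f g)
  ... | yes (p , pos) = unshift p f g (go bound (shift p f) (shift p g)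
          (<-≤-trans (subst (μ (shift p f) + μ (shift p g) <_) (total p f g) (m<m+n _ pos)) le))
  ... | no none = compressed f g (unmoved⇒LC f λ p → m+n≡0⇒m≡0 _ (gain≡0 p)) (unmoved⇒LC g λ p → m+n≡0⇒n≡0 (card (moved p f)) (gain≡0 p))
    where
    gain≡0 : ∀ p → gain p f g ≡ 0
    gain≡0 p = n≤0⇒n≡0 (≮⇒≥ (λ pos → none (p , pos)))

Uniform : ∀ {n} → ℕ → Fam n → Set
Uniform k f = ∀ X → f X ≡ true → ∣ X ∣ ≡ k

shift-Uniform : ∀ {m k} p {f : Fam (suc (suc m))} → Uniform k f → Uniform k (shift p f)
shift-Uniform {k = k} p {f} uf X q with view p X
... | at true true v = uf _ (trans (sym (shift-same f p true v)) q)
... | at false false v = uf _ (trans (sym (shift-same f p false v)) q)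
... | at true false v = uf _ (proj₁ (∧-split {f (insertPair p true false v)} (trans (sym (shift-down f p v)) q)))
... | at false true v with ∨-split {f (insertPair p true false v)} (trans (sym (shift-up f p v)) q)
...   | inj₂ r = uf _ r
...   | inj₁ r = trans (insertPair-size p false true v) (trans (sym (insertPair-size p true false v)) (uf _ r))

shift-Cross : ∀ {m t} p {f g : Fam (suc (suc m))} → Cross t f g → Cross t (shift p f) (shift p g)
shift-Cross {t = t} p {f} {g} cr X Y qX qY with view p X | view p Y
... | at a b v | at a' b' v' = subst (t ≤_) (sym (insertPair-∩-size p a b v a' b' v')) (go a b a' b' qX qY)
  where
  orig : ∀ a b a' b' → f (insertPair p a b v) ≡ true → g (insertPair p a' b' v') ≡ true → t ≤ ⟦ a ∧ a' ⟧ + ⟦ b ∧ b' ⟧ + ∣ v ∩ v' ∣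
  orig a b a' b' p' q' = subst (t ≤_) (insertPair-∩-size p a b v a' b' v') (cr _ _ p' q')
  both : ∀ {h : Fam _} v → shift p h (insertPair p true false v) ≡ true → h (insertPair p true false v) ≡ true × h (insertPair p false true v) ≡ true
  both {h} v q = ∧-split (trans (sym (shift-down h p v)) q)
  either : ∀ {h : Fam _} v → shift p h (insertPair p false true v) ≡ true → h (insertPair p true false v) ≡ true ⊎ h (insertPair p false true v) ≡ true
  either {h} v q = ∨-split (trans (sym (shift-up h p v)) q)
  same : ∀ {h : Fam _} a v → shift p h (insertPair p a a v) ≡ true → h (insertPair p a a v) ≡ true
  same {h} a v q = trans (sym (shift-same h p a v)) q
  go : ∀ a b a' b' → shift p f (insertPair p a b v) ≡ true → shift p g (insertPair p a' b' v') ≡ true → t ≤ ⟦ a ∧ a' ⟧ + ⟦ b ∧ b' ⟧ + ∣ v ∩ v' ∣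
  go true true true true x y = orig true true true true (same {f} true v x) (same {g} true v' y)
  go true true false false x y = orig true true false false (same {f} true v x) (same {g} false v' y)
  go false false true true x y = orig false false true true (same {f} false v x) (same {g} true v' y)
  go false false false false x y = orig false false false false (same {f} false v x) (same {g} false v' y)
  go true true true false x y = orig true true true false (same {f} true v x) (proj₁ (both {g} v' y))
  go false false true false x y = orig false false true false (same {f} false v x) (proj₁ (both {g} v' y))
  go true false true true x y = orig true false true true (proj₁ (both {f} v x)) (same {g} true v' y)
  go true false false false x y = orig true false false false (proj₁ (both {f} v x)) (same {g} false v' y)
  go true true false true x y with either {g} v' y
  ... | inj₁ r = orig true true true false (same {f} true v x) r
  ... | inj₂ r = orig true true false true (same {f} true v x) r
  go false false false true x y with either {g} v' y
  ... | inj₁ r = orig false false true false (same {f} false v x) r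
  ... | inj₂ r = orig false false false true (same {f} false v x) r
  go false true true true x y with either {f} v x
  ... | inj₁ r = orig true false true true r (same {g} true v' y)
  ... | inj₂ r = orig false true true true r (same {g} true v' y)
  go false true false false x y with either {f} v x
  ... | inj₁ r = orig true false false false r (same {g} false v' y)
  ... | inj₂ r = orig false true false false r (same {g} false v' y)
  go true false true false x y = orig true false true false (proj₁ (both {f} v x)) (proj₁ (both {g} v' y))
  go true false false true x y with either {g} v' y
  -- Both versions of X lie in f. Taking the one disjoint on the pair from the known version of Y
  -- puts all common elements into v ∩ v'.
  ... | inj₁ r = orig false true true false (proj₂ (both {f} v x)) r
  ... | inj₂ r = orig true false false true (proj₁ (both {f} v x)) r
  go false true true false x y with either {f} v x
  ... | inj₁ r = orig true false false true r (proj₂ (both {g} v' y))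
  ... | inj₂ r = orig false true true false r (proj₁ (both {g} v' y))
  go false true false true x y with either {f} v x | either {g} v' y
  ... | inj₁ r | inj₁ s = orig true false true false r s
  ... | inj₁ r | inj₂ s = ≤-trans (orig true false false true r s) (n≤1+n _)
  ... | inj₂ r | inj₁ s = ≤-trans (orig false true true false r s) (n≤1+n _)
  ... | inj₂ r | inj₂ s = orig false true false true r s

-- Intersections with a fixed set U

+-pairs : ∀ {a b c d a' b' c' d'} → a + b ≤ c + d → a' + b' ≤ c' + d' → (a + a') + (b + b') ≤ (c + c') + (d + d')
+-pairs {a} {b} {c} {d} {a'} {b'} {c'} {d'} p q =
  subst₂ _≤_ (+-interchange a b a' b') (+-interchange c d c' d') (+-mono-≤ p q)

-- Inclusion-exclusion inside U.
two-traces : ∀ {n} (U v v' : Subset n) → ∣ v ∩ U ∣ + ∣ v' ∩ U ∣ ≤ ∣ U ∣ + ∣ v ∩ v' ∩ U ∣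
two-traces [] [] [] = z≤n
two-traces (u ∷ U) (a ∷ v) (b ∷ v')
  rewrite size-∷ (a ∧ u) (v ∩ U) | size-∷ (b ∧ u) (v' ∩ U) | size-∷ u U | size-∷ (a ∧ b ∧ u) (v ∩ v' ∩ U) =
  +-pairs {⟦ a ∧ u ⟧} {⟦ b ∧ u ⟧} {⟦ u ⟧} (one u a b) (two-traces U v v')
  where
  one : ∀ u a b → ⟦ a ∧ u ⟧ + ⟦ b ∧ u ⟧ ≤ ⟦ u ⟧ + ⟦ a ∧ b ∧ u ⟧
  one true true b = ≤-refl
  one true false true = ≤-refl
  one true false false = z≤n
  one false true true = z≤n
  one false true false = z≤n
  one false false true = z≤n
  one false false false = z≤n

outer-room : ∀ {n} (U v v' : Subset n) →
  n + (∣ v ∩ U ∣ + ∣ v' ∩ U ∣) ≤ (∣ ∁ (U ∪ v ∪ v') ∣ + ∣ U ∣) + (∣ v ∣ + ∣ v' ∣)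
outer-room [] [] [] = z≤n
outer-room {suc n} (u ∷ U) (a ∷ v) (b ∷ v')
  rewrite size-∷ (a ∧ u) (v ∩ U) | size-∷ (b ∧ u) (v' ∩ U) | size-∷ u U | size-∷ a v | size-∷ b v'
        | size-∷ (not (u ∨ a ∨ b)) (∁ (U ∪ v ∪ v')) =
  subst₂ _≤_ (cong (suc n +_) (+-interchange ⟦ a ∧ u ⟧ ⟦ b ∧ u ⟧ ∣ v ∩ U ∣ ∣ v' ∩ U ∣))
    (cong₂ _+_ (+-interchange ⟦ not (u ∨ a ∨ b) ⟧ ⟦ u ⟧ ∣ ∁ (U ∪ v ∪ v') ∣ ∣ U ∣) (+-interchange ⟦ a ⟧ ⟦ b ⟧ ∣ v ∣ ∣ v' ∣))
    (+-pairs {1} {⟦ a ∧ u ⟧ + ⟦ b ∧ u ⟧} {⟦ not (u ∨ a ∨ b) ⟧ + ⟦ u ⟧} {⟦ a ⟧ + ⟦ b ⟧} {n} {∣ v ∩ U ∣ + ∣ v' ∩ U ∣} (one u a b) (outer-room U v v'))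
  where
  one : ∀ u a b → 1 + (⟦ a ∧ u ⟧ + ⟦ b ∧ u ⟧) ≤ (⟦ not (u ∨ a ∨ b) ⟧ + ⟦ u ⟧) + (⟦ a ⟧ + ⟦ b ⟧)
  one true true true = ≤-refl
  one true true false = ≤-refl
  one true false true = ≤-refl
  one true false false = ≤-refl
  one false true true = s≤s z≤n
  one false true false = ≤-refl
  one false false true = ≤-refl
  one false false false = ≤-refl

-- w arises from U by deleting r elements of v ∩ v' ∩ U and adding q elements outside U ∪ v ∪ v'.
exchange : ∀ {n} (U v v' : Subset n) r q → r ≤ ∣ v ∩ v' ∩ U ∣ → q ≤ ∣ ∁ (U ∪ v ∪ v') ∣ →
  ∃[ w ] ∣ w ∣ + r ≡ ∣ U ∣ + q × ∣ w ∩ U ∣ + r ≡ ∣ U ∣ × ∣ v ∩ w ∣ + r ≡ ∣ v ∩ U ∣ × ∣ v' ∩ w ∣ + r ≡ ∣ v' ∩ U ∣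
exchange [] [] [] zero zero _ _ = [] , refl , refl , refl , refl
exchange (true ∷ U) (true ∷ v) (true ∷ v') zero q x y with exchange U v v' zero q z≤n y
... | w , a , b , c , d = true ∷ w , cong suc a , cong suc b , cong suc c , cong suc d
exchange (true ∷ U) (true ∷ v) (true ∷ v') (suc r) q (s≤s x) y with exchange U v v' r q x y
... | w , a , b , c , d = false ∷ w , trans (+-suc _ r) (cong suc a) , trans (+-suc _ r) (cong suc b) , trans (+-suc _ r) (cong suc c) , trans (+-suc _ r) (cong suc d)
exchange (true ∷ U) (true ∷ v) (false ∷ v') r q x y with exchange U v v' r q x y
... | w , a , b , c , d = true ∷ w , cong suc a , cong suc b , cong suc c , d
exchange (true ∷ U) (false ∷ v) (true ∷ v') r q x y with exchange U v v' r q x y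
... | w , a , b , c , d = true ∷ w , cong suc a , cong suc b , c , cong suc d
exchange (true ∷ U) (false ∷ v) (false ∷ v') r q x y with exchange U v v' r q x y
... | w , a , b , c , d = true ∷ w , cong suc a , cong suc b , c , d
exchange (false ∷ U) (false ∷ v) (false ∷ v') r zero x y with exchange U v v' r zero x z≤n
... | w , a , b , c , d = false ∷ w , a , b , c , d
exchange (false ∷ U) (false ∷ v) (false ∷ v') r (suc q) x (s≤s y) with exchange U v v' r q x y
... | w , a , b , c , d = true ∷ w , trans (cong suc a) (sym (+-suc _ q)) , b , c , d
exchange (false ∷ U) (true ∷ v) (true ∷ v') r q x y with exchange U v v' r q x y
... | w , a , b , c , d = false ∷ w , a , b , c , d
exchange (false ∷ U) (true ∷ v) (false ∷ v') r q x y with exchange U v v' r q x y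
... | w , a , b , c , d = false ∷ w , a , b , c , d
exchange (false ∷ U) (false ∷ v) (true ∷ v') r q x y with exchange U v v' r q x y
... | w , a , b , c , d = false ∷ w , a , b , c , d

-- Undoing a shift

-- For s = t + r and U of size t + 2r these are the Frankl families.
record Threshold {n} (k s : ℕ) (U : Subset n) (f : Fam n) : Set where
  field
    to   : ∀ X → f X ≡ true → ∣ X ∣ ≡ k × s ≤ ∣ X ∩ U ∣
    from : ∀ X → ∣ X ∣ ≡ k → s ≤ ∣ X ∩ U ∣ → f X ≡ true
open Threshold

Threshold-cong : ∀ {n k s} {U : Subset n} {f g : Fam n} → (∀ X → f X ≡ g X) → Threshold k s U f → Threshold k s U g
Threshold-cong eq th = record
  { to = λ X q → to th X (trans (eq X) q)
  ; from = λ X a b → trans (sym (eq X)) (from th X a b) }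

shift-fixed : ∀ {m} p {f : Fam (suc (suc m))} → (∀ v → f (insertPair p true false v) ≡ true → f (insertPair p false true v) ≡ true) →
              ∀ X → shift p f X ≡ f X
shift-fixed p {f} h X with view p X
... | at true true v = shift-same f p true v
... | at false false v = shift-same f p false v
... | at true false v rewrite shift-down f p v with f (insertPair p true false v) in eq
...   | true = h v eq
...   | false = refl
shift-fixed p {f} h X | at false true v rewrite shift-up f p v with f (insertPair p true false v) in eq
...   | true = sym (h v eq)
...   | false = refl

module Unshift (t₁ κ z m : ℕ) (t₁≥2 : 2 ≤ t₁) (size : suc (suc m) ≡ suc (suc t₁) * suc κ + z)
               (r : ℕ) (r≤1 : r ≤ 1) (p : Fin (suc m)) where

  private
    k = t₁ + suc κ
    t = suc t₁

  -- The ambiguous sets when U holds only the smaller element of the pair: adding that element to v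
  -- reaches the threshold, adding the larger one does not. So exactly one of the two sets was
  -- present before the shift.
  Critical : Subset m → Subset m → Set
  Critical U v = ∣ v ∣ ≡ t₁ + κ × ∣ v ∩ U ∣ ≡ t₁ + r

  -- w is U with r elements of v ∩ v' ∩ U traded for κ - r elements outside U ∪ v ∪ v'. There are at
  -- least t₁ ≥ r of the former, by inclusion-exclusion, and at least t₁ κ + z ≥ κ of the latter, by
  -- the size of n.
  common-neighbour : ∀ U → ∣ U ∣ ≡ t₁ + (r + r) → ∀ v v' → Critical U v → Critical U v' →
    ∃[ w ] Critical U w × ∣ v ∩ w ∣ ≡ t₁ × ∣ v' ∩ w ∣ ≡ t₁
  common-neighbour U U≡ v v' (v≡ , vU) (v'≡ , v'U) with ≤-witness r≤κ
    where
    r≤κ : r ≤ κ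
    r≤κ = +-cancelˡ-≤ t₁ r κ (subst₂ _≤_ vU v≡ (∣p∩q∣≤∣p∣ v U))
  ... | q , κ≡ with exchange U v v' r q inner outer
    where
    inner : r ≤ ∣ v ∩ v' ∩ U ∣
    inner = ≤-trans r≤1 (≤-trans (≤-trans (s≤s z≤n) t₁≥2) (+-cancelˡ-≤ (t₁ + (r + r)) t₁ _
      (≤-trans (≤-reflexive (trans (e t₁ r) (sym (cong₂ _+_ vU v'U)))) (≤-trans (two-traces U v v') (≤-reflexive (cong (_+ ∣ v ∩ v' ∩ U ∣) U≡))))))
      where
      e : ∀ t r → (t + (r + r)) + t ≡ (t + r) + (t + r)
      e = solve-∀
    outer : q ≤ ∣ ∁ (U ∪ v ∪ v') ∣
    outer = ≤-trans (≤-trans (m≤n+m q r) (≤-reflexive (sym κ≡))) (≤-trans (m≤n*m κ t₁ {{>-nonZero (≤-trans (s≤s z≤n) t₁≥2)}})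
      (≤-trans (m≤m+n (t₁ * κ) z) (+-cancelʳ-≤ (t₁ + (r + r) + ((t₁ + κ) + (t₁ + κ))) _ _ (begin
        t₁ * κ + z + (t₁ + (r + r) + ((t₁ + κ) + (t₁ + κ))) ≡⟨ e₁ t₁ κ z r ⟩
        t₁ * κ + (κ + κ) + t₁ + z + ((t₁ + r) + (t₁ + r)) ≡⟨ sym (cong₂ _+_ m≡ (cong₂ _+_ vU v'U)) ⟩
        m + (∣ v ∩ U ∣ + ∣ v' ∩ U ∣) ≤⟨ outer-room U v v' ⟩
        (∣ ∁ (U ∪ v ∪ v') ∣ + ∣ U ∣) + (∣ v ∣ + ∣ v' ∣) ≡⟨ cong₂ _+_ (cong (∣ ∁ (U ∪ v ∪ v') ∣ +_) U≡) (cong₂ _+_ v≡ v'≡) ⟩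
        (∣ ∁ (U ∪ v ∪ v') ∣ + (t₁ + (r + r))) + ((t₁ + κ) + (t₁ + κ)) ≡⟨ +-assoc ∣ ∁ (U ∪ v ∪ v') ∣ _ _ ⟩
        ∣ ∁ (U ∪ v ∪ v') ∣ + (t₁ + (r + r) + ((t₁ + κ) + (t₁ + κ))) ∎))))
      where
      open ≤-Reasoning
      e₀ : ∀ t κ z → suc (suc t) * suc κ + z ≡ suc (suc (t * κ + (κ + κ) + t + z))
      e₀ = solve-∀
      e₁ : ∀ t κ z r → t * κ + z + (t + (r + r) + ((t + κ) + (t + κ))) ≡ t * κ + (κ + κ) + t + z + ((t + r) + (t + r))
      e₁ = solve-∀
      m≡ : m ≡ t₁ * κ + (κ + κ) + t₁ + z
      m≡ = suc-injective (suc-injective (trans size (e₀ t₁ κ z)))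
  ...   | w , w≡ , wU , vw , v'w = w , (cancel (trans w≡ (trans (cong (_+ q) U≡) (trans (e t₁ r q) (cong (λ x → t₁ + x + r) (sym κ≡))))) ,
            cancel (trans wU (trans U≡ (sym (+-assoc t₁ r r))))) , cancel (trans vw vU) , cancel (trans v'w v'U)
    where
    cancel : ∀ {x y} → x + r ≡ y + r → x ≡ y
    cancel = +-cancelʳ-≡ r _ _
    e : ∀ t r q → t + (r + r) + q ≡ t + (r + q) + r
    e = solve-∀

  private
    F = Fam (suc (suc m))
    s = t + r

  module _ {h : F} {u₁ u₂ : Bool} {U : Subset m} (th : Threshold k s (insertPair p u₁ u₂ U) (shift p h)) where

    up-member : ∀ v → shift p h (insertPair p false true v) ≡ true → ∣ v ∣ ≡ t₁ + κ × s ≤ ⟦ u₂ ⟧ + ∣ v ∩ U ∣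
    up-member v q with to th (insertPair p false true v) q
    ... | a , b = suc-injective (trans (sym (insertPair-size p false true v)) (trans a (+-suc t₁ κ))) ,
          subst (s ≤_) (insertPair-∩-size p false true v u₁ u₂ U) b

    down-member : ∀ v → ∣ v ∣ ≡ t₁ + κ → s ≤ ⟦ u₁ ⟧ + 0 + ∣ v ∩ U ∣ → shift p h (insertPair p true false v) ≡ true
    down-member v a b = from th (insertPair p true false v) (trans (insertPair-size p true false v) (trans (cong suc a) (sym (+-suc t₁ κ))))
      (subst (s ≤_) (sym (insertPair-∩-size p true false v u₁ u₂ U)) b)

    fixed-unless : (∀ v → h (insertPair p true false v) ≡ true → ∣ v ∣ ≡ t₁ + κ → s ≤ ⟦ u₂ ⟧ + ∣ v ∩ U ∣ →
                          ¬ (s ≤ ⟦ u₁ ⟧ + 0 + ∣ v ∩ U ∣) → h (insertPair p false true v) ≡ true) →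
                   ∀ v → h (insertPair p true false v) ≡ true → h (insertPair p false true v) ≡ true
    fixed-unless c v q with up-member v (trans (shift-up h p v) (∨-inl q)) | s ≤? ⟦ u₁ ⟧ + 0 + ∣ v ∩ U ∣
    ... | a , b | no nle = c v q a b nle
    ... | a , b | yes le = proj₂ (∧-split {h (insertPair p true false v)} (trans (sym (shift-down h p v)) (down-member v a le)))

  module _ {U : Subset m} (U≡ : ∣ U ∣ ≡ t₁ + (r + r)) where

    private
      Ũ = insertPair p false true U

    critical : ∀ v → ∣ v ∣ ≡ t₁ + κ → s ≤ 1 + ∣ v ∩ U ∣ → ¬ (s ≤ ∣ v ∩ U ∣) → Critical U v
    critical v a b nle = a , ≤-antisym (≤-pred (≰⇒> nle)) (≤-pred b)

    critical-up : ∀ {h : F} → Threshold k s Ũ (shift p h) → ∀ v → Critical U v →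
                  h (insertPair p true false v) ≡ true ⊎ h (insertPair p false true v) ≡ true
    critical-up {h} th v (a , b) = ∨-split (trans (sym (shift-up h p v)) (from th (insertPair p false true v)
      (trans (insertPair-size p false true v) (trans (cong suc a) (sym (+-suc t₁ κ))))
      (subst (s ≤_) (sym (insertPair-∩-size p false true v false true U)) (≤-reflexive (cong suc (sym b))))))

    -- Critical v and w with ∣ v ∩ w ∣ = t₁ are adjacent: the set of f obtained from v by adding the
    -- one element and the set of g obtained from w by adding the other meet in t₁ elements only.
    module _ {f g : F} (cr : Cross t f g) (tg : Threshold k s Ũ (shift p g)) where

      up⇒up : ∀ v w → Critical U w → ∣ v ∩ w ∣ ≡ t₁ → f (insertPair p false true v) ≡ true → g (insertPair p false true w) ≡ true
      up⇒up v w cw int q with critical-up {g} tg w cw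
      ... | inj₂ q' = q'
      ... | inj₁ q' = contradiction (subst (t ≤_) (trans (insertPair-∩-size p false true v true false w) int) (cr (insertPair p false true v) (insertPair p true false w) q q')) (<⇒≱ (n<1+n t₁))

      down⇒down : ∀ v w → Critical U w → ∣ v ∩ w ∣ ≡ t₁ → f (insertPair p true false v) ≡ true → g (insertPair p true false w) ≡ true
      down⇒down v w cw int q with critical-up {g} tg w cw
      ... | inj₁ q' = q'
      ... | inj₂ q' = contradiction (subst (t ≤_) (trans (insertPair-∩-size p true false v false true w) int) (cr (insertPair p true false v) (insertPair p false true w) q q')) (<⇒≱ (n<1+n t₁))

    ∩-size-comm : ∀ {n c} (v w : Subset n) → ∣ v ∩ w ∣ ≡ c → ∣ w ∩ v ∣ ≡ c
    ∩-size-comm v w = trans (cong ∣_∣ (∩-comm w v))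

    module _ {f g : F} (cr : Cross t f g) (tf : Threshold k s Ũ (shift p f)) (tg : Threshold k s Ũ (shift p g))
             (v₀ : Subset m) (c₀ : Critical U v₀) where

      -- One edge carries the choice from f to g, the next one back to f.
      all-up : f (insertPair p false true v₀) ≡ true → ∀ v → Critical U v → f (insertPair p false true v) ≡ true
      all-up q v cv = let w , cw , i , j = common-neighbour U U≡ v₀ v c₀ cv in
        up⇒up {g} {f} (Cross-sym cr) tf w v cv (∩-size-comm v w j) (up⇒up {f} {g} cr tg v₀ w cw i q)

      all-upʳ : f (insertPair p false true v₀) ≡ true → ∀ v → Critical U v → g (insertPair p false true v) ≡ true
      -- A common neighbour of v with itself is simply a neighbour; the edge from it leads from f to
      -- g.
      all-upʳ q v cv = let x , cx , i' , _ = common-neighbour U U≡ v v cv cv in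
        up⇒up {f} {g} cr tg x v cv (∩-size-comm v x i') (all-up q x cx)

      all-down : f (insertPair p true false v₀) ≡ true → ∀ v → Critical U v → f (insertPair p true false v) ≡ true
      all-down q v cv = let w , cw , i , j = common-neighbour U U≡ v₀ v c₀ cv in
        down⇒down {g} {f} (Cross-sym cr) tf w v cv (∩-size-comm v w j) (down⇒down {f} {g} cr tg v₀ w cw i q)

      all-downʳ : f (insertPair p true false v₀) ≡ true → ∀ v → Critical U v → g (insertPair p true false v) ≡ true
      all-downʳ q v cv = let x , cx , i' , _ = common-neighbour U U≡ v v cv cv in
        down⇒down {f} {g} cr tg x v cv (∩-size-comm v x i') (all-down q x cx)

    up-threshold : ∀ {h : F} → Threshold k s Ũ (shift p h) →
                   (∀ v → Critical U v → h (insertPair p false true v) ≡ true) → Threshold k s Ũ h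
    up-threshold {h} th up = Threshold-cong (shift-fixed p (fixed-unless {h} th (λ v _ a b nle → up v (critical v a b nle)))) th

    -- When all critical sets have the larger element, h is `shift p h` with the two places
    -- interchanged.
    down-threshold : ∀ {h : F} → Threshold k s Ũ (shift p h) →
                     (∀ v → Critical U v → h (insertPair p true false v) ≡ true) → Threshold k s (insertPair p true false U) h
    down-threshold {h} th down = record { to = to' ; from = from' }
      where
      swap : ∀ a b v → ∣ insertPair p a b v ∩ insertPair p true false U ∣ ≡ ∣ insertPair p b a v ∩ insertPair p false true U ∣
      swap a b v = trans (insertPair-∩-size p a b v true false U) (trans (cong (_+ ∣ v ∩ U ∣) (lem a b)) (sym (insertPair-∩-size p b a v false true U)))
        where
        lem : ∀ a b → ⟦ a ∧ true ⟧ + ⟦ b ∧ false ⟧ ≡ ⟦ b ∧ false ⟧ + ⟦ a ∧ true ⟧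
        lem a b = +-comm ⟦ a ∧ true ⟧ _
      size-swap : ∀ a b v → ∣ insertPair p a b v ∣ ≡ ∣ insertPair p b a v ∣
      size-swap a b v = trans (insertPair-size p a b v) (trans (cong (_+ ∣ v ∣) (+-comm ⟦ a ⟧ _)) (sym (insertPair-size p b a v)))
      swapped : ∀ a b v → h (insertPair p a b v) ≡ shift p h (insertPair p b a v)
      swapped true true v = sym (shift-same h p true v)
      swapped false false v = sym (shift-same h p false v)
      swapped true false v with h (insertPair p true false v) in eq
      ... | true = sym (trans (shift-up h p v) (∨-inl eq))
      ... | false = sym (trans (shift-up h p v) (trans (cong (_∨ h (insertPair p false true v)) eq)
              (bool-cases _ λ q → true≢false (trans (sym (down-of v q)) eq))))
        where
        true≢false : true ≡ false → ⊥
        true≢false ()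
        down-of : ∀ v → h (insertPair p false true v) ≡ true → h (insertPair p true false v) ≡ true
        down-of v q with up-member {h} th v (trans (shift-up h p v) (∨-inr {a = h (insertPair p true false v)} q)) | s ≤? ∣ v ∩ U ∣
        ... | a , b | yes le = proj₁ (∧-split (trans (sym (shift-down h p v)) (down-member {h} th v a le)))
        ... | a , b | no nle = down v (critical v a b nle)
      swapped false true v with h (insertPair p false true v) in eq
      ... | false = sym (trans (shift-down h p v) (trans (cong (h (insertPair p true false v) ∧_) eq) (∧-zeroʳ _)))
      ... | true = sym (trans (shift-down h p v) (∧-pair (down-of v eq) eq))
        where
        down-of : ∀ v → h (insertPair p false true v) ≡ true → h (insertPair p true false v) ≡ true
        down-of v q with up-member {h} th v (trans (shift-up h p v) (∨-inr {a = h (insertPair p true false v)} q)) | s ≤? ∣ v ∩ U ∣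
        ... | a , b | yes le = proj₁ (∧-split (trans (sym (shift-down h p v)) (down-member {h} th v a le)))
        ... | a , b | no nle = down v (critical v a b nle)
      to' : ∀ X → h X ≡ true → ∣ X ∣ ≡ k × s ≤ ∣ X ∩ insertPair p true false U ∣
      to' X q with view p X
      ... | at a b v with to th _ (trans (sym (swapped a b v)) q)
      ...   | x , y = trans (size-swap a b v) x , subst (s ≤_) (sym (swap a b v)) y
      from' : ∀ X → ∣ X ∣ ≡ k → s ≤ ∣ X ∩ insertPair p true false U ∣ → h X ≡ true
      from' X x y with view p X
      ... | at a b v = trans (swapped a b v) (from th _ (trans (size-swap b a v) x) (subst (s ≤_) (swap a b v) y))

  Solved : F → F → Set
  Solved f g = Σ (Subset (suc (suc m))) λ U → ∣ U ∣ ≡ t + (r + r) × Threshold k s U f × Threshold k s U g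

  unshift : ∀ {f g : F} → Cross t f g → Solved (shift p f) (shift p g) → Solved f g
  unshift {f} {g} cr (U , U≡ , tf , tg) with view p U
  -- If U holds the larger element, a shifted set that reaches the threshold brings its unshifted
  -- version along. So both were present and nothing moved.
  ... | at true u₂ U' = insertPair p true u₂ U' , U≡ , stay {f} tf , stay {g} tg
    where
    stay : ∀ {h : F} → Threshold k s (insertPair p true u₂ U') (shift p h) → Threshold k s (insertPair p true u₂ U') h
    stay {h} th = Threshold-cong (shift-fixed p (fixed-unless {h} th λ v _ _ b nle → contradiction (≤-trans b (+-monoˡ-≤ ∣ v ∩ U' ∣ (one u₂))) nle)) th
      where
      one : ∀ b → ⟦ b ⟧ ≤ 1
      one true = ≤-refl
      one false = z≤n
  ... | at false false U' = insertPair p false false U' , U≡ , stay {f} tf , stay {g} tg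
    where
    stay : ∀ {h : F} → Threshold k s (insertPair p false false U') (shift p h) → Threshold k s (insertPair p false false U') h
    stay {h} th = Threshold-cong (shift-fixed p (fixed-unless {h} th λ v _ _ b nle → contradiction b nle)) th
  ... | at false true U' with positive-or-zero (card (λ v → level (t₁ + κ) v ∧ (∣ v ∩ U' ∣ ≡ᵇ t₁ + r)))
  ...   | inj₁ none = insertPair p false true U' , U≡ , up-threshold U'≡ {f} tf (absent f) , up-threshold U'≡ {g} tg (absent g)
    where
    U'≡ : ∣ U' ∣ ≡ t₁ + (r + r)
    U'≡ = suc-injective (trans (sym (insertPair-size p false true U')) U≡)
    absent : ∀ (h : F) v → Critical U' v → h (insertPair p false true v) ≡ true
    absent h v (a , b) = contradiction (subst (1 ≤_) none (≤-trans (≤-reflexive (sym (true⇒⟦⟧≡1 (∧-pair (level-true v a)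
      (trans (cong (_≡ᵇ t₁ + r) b) (≡ᵇ-refl (t₁ + r))))))) (term≤∑ (λ v → ⟦ level (t₁ + κ) v ∧ (∣ v ∩ U' ∣ ≡ᵇ t₁ + r) ⟧) v))) λ ()
  ...   | inj₂ some with ∑>0⇒∃ (λ v → ⟦ level (t₁ + κ) v ∧ (∣ v ∩ U' ∣ ≡ᵇ t₁ + r) ⟧) some
  ...     | v₀ , pos = colour (critical-up U'≡ {f} tf v₀ c₀)
    where
    U'≡ : ∣ U' ∣ ≡ t₁ + (r + r)
    U'≡ = suc-injective (trans (sym (insertPair-size p false true U')) U≡)
    c₀ : Critical U' v₀
    c₀ = let a , b = ∧-split {level (t₁ + κ) v₀} (⟦⟧>0 pos) in ≡ᵇ-sound _ _ a , ≡ᵇ-sound _ _ b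
    colour : f (insertPair p true false v₀) ≡ true ⊎ f (insertPair p false true v₀) ≡ true → Solved f g
    colour (inj₂ q) = insertPair p false true U' , U≡ , up-threshold U'≡ {f} tf (all-up U'≡ {f} {g} cr tf tg v₀ c₀ q) ,
      up-threshold U'≡ {g} tg (all-upʳ U'≡ {f} {g} cr tf tg v₀ c₀ q)
    colour (inj₁ q) = insertPair p true false U' , trans (insertPair-size p true false U') (cong suc U'≡) ,
      down-threshold U'≡ {f} tf (all-down U'≡ {f} {g} cr tf tg v₀ c₀ q) , down-threshold U'≡ {g} tg (all-downʳ U'≡ {f} {g} cr tf tg v₀ c₀ q)

-- From compressed to arbitrary uniform families

card-W : ∀ {n k} {f : Fam n} → Uniform k f → W 0 k f ≡ card f
card-W {k = k} {f} uf = ∑-cong pointwise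
  where
  pointwise : ∀ X → ⟦ f X ⟧ * wt 0 k ∣ X ∣ ≡ ⟦ f X ⟧
  pointwise X with f X in eq
  ... | false = refl
  ... | true rewrite uf X eq | wt0 k k | ≡ᵇ-refl k = refl

≤ᵇ-sound : ∀ m n → (m ≤ᵇ n) ≡ true → m ≤ n
≤ᵇ-sound m n p = ≤ᵇ⇒≤ m n (subst T (sym p) _)

≤ᵇ-complete : ∀ m n → m ≤ n → (m ≤ᵇ n) ≡ true
≤ᵇ-complete m n p with m ≤ᵇ n | ≤⇒≤ᵇ p
... | true | _ = refl

threshold : ∀ {n} → ℕ → ℕ → Subset n → Fam n
threshold k s U X = level k X ∧ (s ≤ᵇ ∣ X ∩ U ∣)

threshold-spec : ∀ {n} k s (U : Subset n) → Threshold k s U (threshold k s U)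
threshold-spec k s U = record
  { to = λ X q → let a , b = ∧-split {level k X} q in ≡ᵇ-sound _ _ a , ≤ᵇ-sound s _ b
  ; from = λ X a b → ∧-pair (level-true X a) (≤ᵇ-complete s _ b) }

threshold-cross : ∀ {n} k {t r} {U : Subset n} → ∣ U ∣ ≡ t + (r + r) → Cross t (threshold k (t + r) U) (threshold k (t + r) U)
threshold-cross k {t} {r} {U} U≡ X Y p q = ≤-trans (+-cancelˡ-≤ (t + (r + r)) t _ (begin
  t + (r + r) + t ≡⟨ e t r ⟩
  (t + r) + (t + r) ≤⟨ +-mono-≤ (proj₂ (to (threshold-spec k (t + r) U) X p)) (proj₂ (to (threshold-spec k (t + r) U) Y q)) ⟩
  ∣ X ∩ U ∣ + ∣ Y ∩ U ∣ ≤⟨ two-traces U X Y ⟩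
  ∣ U ∣ + ∣ X ∩ Y ∩ U ∣ ≡⟨ cong₂ _+_ U≡ (cong ∣_∣ (sym (∩-assoc X Y U))) ⟩
  t + (r + r) + ∣ (X ∩ Y) ∩ U ∣ ∎)) (∣p∩q∣≤∣p∣ (X ∩ Y) U)
  where
  open ≤-Reasoning
  e : ∀ t r → t + (r + r) + t ≡ (t + r) + (t + r)
  e = solve-∀

squeeze-card : ∀ {n} {f g h : Fam n} → (∀ X → f X ≡ true → h X ≡ true) → card g ≤ card h → 0 < card h →
               card h * card h ≤ card f * card g → ∀ X → f X ≡ h X
squeeze-card {f = f} {g} {h} f⊆h g≤h h>0 le X with f X | h X | ∑-squeeze (λ X → ⟦⟧-mono (f⊆h X)) h≤f X
  where
  h≤f : card h ≤ card f
  h≤f = *-cancelʳ-≤ (card h) (card f) (card h) {{>-nonZero h>0}} (≤-trans le (*-monoʳ-≤ (card f) g≤h))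
... | true | true | _ = refl
... | false | false | _ = refl

module Theorem (t₁ κ z N₀ : ℕ) (t₁≥2 : 2 ≤ t₁) (size₀ : N₀ + suc t₁ ≡ suc (suc t₁) * suc κ + z) where

  private
    k = t₁ + suc κ
    t = suc t₁
    M = (N₀ C κ) * (N₀ C κ)

    M>0 : 0 < M
    M>0 = *-mono-≤ C>0' C>0'
      where
      e : ∀ t κ z → suc (suc t) * suc κ + z ≡ κ + suc t + (t * κ + κ + 1 + z)
      e = solve-∀
      C>0' : 0 < N₀ C κ
      C>0' = C>0 (+-cancelʳ-≤ t κ N₀ (≤-trans (≤-by _ (e t₁ κ z)) (≤-reflexive (sym size₀))))

  compressed : ∀ {n} → n ≡ N₀ + t → {f g : Fam n} → LeftCompressed f → LeftCompressed g → Cross t f g → Bounded t 0 k M f g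
  -- The descent starts at s = n, where N = 0 and the traces are the sets themselves.
  compressed refl = Descent.compressed-bound t₁ κ z M N₀ t₁≥2 size₀ refl N₀ 0 size₀

  too-small : ∀ {n} → n ≡ N₀ + t → n < 2 → ⊥
  too-small refl p = <⇒≱ (≤-trans p t₁≥2) (≤-trans (n≤1+n t₁) (m≤n+m t N₀))

  product-bound : ∀ {n} → n ≡ N₀ + t → (f g : Fam n) → Uniform k f → Uniform k g → Cross t f g → card f * card g ≤ M
  product-bound {zero} eq = ⊥-elim (too-small eq z<s)
  product-bound {suc zero} eq = ⊥-elim (too-small eq (s≤s z<s))
  product-bound {suc (suc m)} eq = compression-induction
    (λ f g → Uniform k f → Uniform k g → Cross t f g → card f * card g ≤ M)
    (λ f g lf lg uf ug cr → subst₂ (λ x y → x * y ≤ M) (card-W uf) (card-W ug) (proj₁ (compressed eq lf lg cr)))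
    (λ p f g ih uf ug cr → subst₂ (λ x y → x * y ≤ M) (shift-card p f) (shift-card p g)
      (ih (shift-Uniform p uf) (shift-Uniform p ug) (shift-Cross p cr)))

  Extremal : ∀ {n} → Fam n → Fam n → Set
  Extremal {n} f g = ∃[ r ] r ≤ 1 × Σ (Subset n) λ U → ∣ U ∣ ≡ t + (r + r) × Threshold k (t + r) U f × Threshold k (t + r) U g

  -- The threshold family h is t-intersecting, so the product bound for (h, h) gives |h|² ≤ M =
  -- |f||g|, and containment in h becomes equality.
  concentrated-extremal : ∀ {n} → n ≡ N₀ + t → {f g : Fam n} → Uniform k f → Uniform k g → card f * card g ≡ M →
    Concentrated t 0 k M f g → Extremal f g
  concentrated-extremal eq {f} {g} uf ug fg≡M (r , U , r≤1 , U≡ , cf , cg) =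
    r , r≤1 , U , U≡ , Threshold-cong (λ X → sym (f≡h X)) spec , Threshold-cong (λ X → sym (g≡h X)) spec
    where
    h = threshold k (t + r) U
    spec = threshold-spec k (t + r) U
    uh : Uniform k h
    uh X q = proj₁ (to spec X q)
    below : ∀ {f} → Uniform k f → (∀ X → f X ≡ true → 0 < wt 0 k ∣ X ∣ → t + r ≤ ∣ X ∩ U ∣) → ∀ X → f X ≡ true → h X ≡ true
    below uf c X q = from spec X (uf X q) (c X q (subst (0 <_) (sym (trans (cong (wt 0 k) (uf X q)) (trans (wt0 k k) (cong ⟦_⟧ (≡ᵇ-refl k))))) z<s))
    f⊆h = below {f} uf cf
    g⊆h = below {g} ug cg
    f≤h = ∑-mono (λ X → ⟦⟧-mono (f⊆h X))
    g≤h = ∑-mono (λ X → ⟦⟧-mono (g⊆h X))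
    hh≤ : card h * card h ≤ card f * card g
    hh≤ = ≤-trans (product-bound eq h h uh uh (threshold-cross k {t} {r} U≡)) (≤-reflexive (sym fg≡M))
    h>0 : 0 < card h
    h>0 = proj₁ (product>0 (card h) (<-≤-trans M>0 (≤-trans (≤-reflexive (sym fg≡M)) (*-mono-≤ f≤h g≤h))))
    f≡h = squeeze-card {f = f} {g} {h} f⊆h g≤h h>0 hh≤
    g≡h = squeeze-card {f = g} {f} {h} g⊆h f≤h h>0 (≤-trans hh≤ (≤-reflexive (*-comm (card f) (card g))))

  extremal : ∀ {n} → n ≡ N₀ + t → (f g : Fam n) → Uniform k f → Uniform k g → Cross t f g →
             card f * card g ≡ M → Extremal f g
  extremal {zero} eq = ⊥-elim (too-small eq z<s)
  extremal {suc zero} eq = ⊥-elim (too-small eq (s≤s z<s))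
  extremal {suc (suc m)} eq = compression-induction
    (λ f g → Uniform k f → Uniform k g → Cross t f g → card f * card g ≡ M → Extremal f g) base step
    where
    base : ∀ f g → LeftCompressed f → LeftCompressed g → Uniform k f → Uniform k g → Cross t f g → card f * card g ≡ M → Extremal f g
    base f g lf lg uf ug cr fg≡M with proj₂ (compressed eq lf lg cr)
    ... | inj₁ lt = contradiction (subst₂ (λ x y → x * y < M) (card-W uf) (card-W ug) lt) (<-irrefl fg≡M)
    ... | inj₂ c = concentrated-extremal eq uf ug fg≡M c
    step : ∀ p f g → (Uniform k (shift p f) → Uniform k (shift p g) → Cross t (shift p f) (shift p g) →
      card (shift p f) * card (shift p g) ≡ M → Extremal (shift p f) (shift p g)) →
      Uniform k f → Uniform k g → Cross t f g → card f * card g ≡ M → Extremal f g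
    step p f g ih uf ug cr fg≡M =
      let r , r≤1 , solved = ih (shift-Uniform p uf) (shift-Uniform p ug) (shift-Cross p cr)
                               (trans (cong₂ _*_ (shift-card p f) (shift-card p g)) fg≡M)
      in r , r≤1 , Unshift.unshift t₁ κ z m t₁≥2 (trans eq size₀) r r≤1 p {f} {g} cr solved

-- Families as lists

_≟ˢ_ : ∀ {n} → (X Y : Subset n) → Dec (X ≡ Y)
_≟ˢ_ = ≡-dec Data.Bool._≟_

_∈ˢ?_ : ∀ {n} (X : Subset n) (A : Family n) → Dec (X ∈ A)
_∈ˢ?_ = DecMembership._∈?_ _≟ˢ_

indicator : ∀ {n} → Family n → Fam n
indicator A X = does (X ∈ˢ? A)

indicator-∈ : ∀ {n} {A : Family n} {X} → X ∈ A → indicator A X ≡ true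
indicator-∈ {A = A} {X} = dec-true (X ∈ˢ? A)

∈-indicator : ∀ {n} {A : Family n} {X} → indicator A X ≡ true → X ∈ A
∈-indicator {A = A} {X} p with X ∈ˢ? A
... | yes q = q

card-singleton : ∀ {n} (a : Subset n) (f : Fam n) → f a ≡ true → (∀ X → f X ≡ true → X ≡ a) → card f ≡ 1
card-singleton [] f p _ = true⇒⟦⟧≡1 p
card-singleton (false ∷ a) f p h = cong₂ _+_
  (card-singleton a (f ↾ outside) p (λ X q → ∷-injectiveʳ (h _ q)))
  (∑-zero {φ = λ X → ⟦ f (inside ∷ X) ⟧} (λ X → cong ⟦_⟧ (bool-cases _ λ q → case h (inside ∷ X) q of λ ())))
card-singleton (true ∷ a) f p h = cong₂ _+_
  (∑-zero {φ = λ X → ⟦ f (outside ∷ X) ⟧} (λ X → cong ⟦_⟧ (bool-cases _ λ q → case h (outside ∷ X) q of λ ())))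
  (card-singleton a (f ↾ inside) p (λ X q → ∷-injectiveʳ (h _ q)))

card-indicator : ∀ {n} {A : Family n} → Unique A → card (indicator A) ≡ length A
card-indicator {n} {[]} [] = ∑-zero {n} (λ _ → refl)
card-indicator {n} {a ∷ A} (a∉ ∷ u) = trans (∑-cong pointwise) (trans (∑-+ (λ X → ⟦ does (X ≟ˢ a) ⟧) _)
  (cong₂ _+_ (card-singleton a (λ X → does (X ≟ˢ a)) (dec-true (a ≟ˢ a) refl) (λ X → only X)) (card-indicator u)))
  where
  only : ∀ X → does (X ≟ˢ a) ≡ true → X ≡ a
  only X p with X ≟ˢ a
  ... | yes q = q
  pointwise : ∀ X → ⟦ indicator (a ∷ A) X ⟧ ≡ ⟦ does (X ≟ˢ a) ⟧ + ⟦ indicator A X ⟧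
  pointwise X with X ≟ˢ a
  ... | yes refl = cong suc (sym (cong ⟦_⟧ (bool-cases (indicator A X) λ q → All.lookup a∉ (∈-indicator q) refl)))
  ... | no _ = refl

members : ∀ {n} → Fam n → Family n
members {zero} f = if f [] then [] ∷ [] else []
members {suc n} f = map (outside ∷_) (members (f ↾ outside)) ++ map (inside ∷_) (members (f ↾ inside))

members-sound : ∀ {n} (f : Fam n) {X} → X ∈ members f → f X ≡ true
members-sound {zero} f {[]} X∈ with f []
... | true = refl
members-sound {zero} f {[]} () | false
members-sound {suc n} f X∈ with ∈-++⁻ (map (outside ∷_) (members (f ↾ outside))) X∈
... | inj₁ p with ∈-map⁻ (outside ∷_) p
...   | Y , q , refl = members-sound (f ↾ outside) q
members-sound {suc n} f X∈ | inj₂ p with ∈-map⁻ (inside ∷_) p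
...   | Y , q , refl = members-sound (f ↾ inside) q

members-length : ∀ {n} (f : Fam n) → length (members f) ≡ card f
members-length {zero} f with f []
... | true = refl
... | false = refl
members-length {suc n} f = trans (length-++ (map (outside ∷_) (members (f ↾ outside)))) (cong₂ _+_
  (trans (length-map (outside ∷_) (members (f ↾ outside))) (members-length (f ↾ outside)))
  (trans (length-map (inside ∷_) (members (f ↾ inside))) (members-length (f ↾ inside))))

members-unique : ∀ {n} (f : Fam n) → Unique (members f)
members-unique {zero} f with f []
... | true = [] ∷ []
... | false = []
members-unique {suc n} f = Unique.++⁺ (Unique.map⁺ ∷-injectiveʳ (members-unique (f ↾ outside)))
  (Unique.map⁺ ∷-injectiveʳ (members-unique (f ↾ inside))) disjoint
  where
  disjoint : ∀ {X} → ¬ (X ∈ map (outside ∷_) (members (f ↾ outside)) × X ∈ map (inside ∷_) (members (f ↾ inside)))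
  disjoint (p , q) with ∈-map⁻ (outside ∷_) p | ∈-map⁻ (inside ∷_) q
  ... | _ , _ , refl | _ , _ , ()

-- The sets containing the t smallest elements

star : ∀ N t → Fam (N + t)
star zero t X = level t X
star (suc N) t (b ∷ X) = star N t X

star-count : ∀ N t k → # (star N t) k ≡ wt N k t
star-count zero t k = begin
  ∑ (λ (X : Subset t) → ⟦ level t X ∧ level k X ⟧) ≡⟨ ∑-cong {t} pointwise ⟩
  ∑ (λ (X : Subset t) → ⟦ level t X ⟧ * ⟦ t ≡ᵇ k ⟧) ≡⟨ ∑-* {t} (λ X → ⟦ level t X ⟧) ⟦ t ≡ᵇ k ⟧ ⟩
  ∑ (λ (X : Subset t) → ⟦ level t X ⟧) * ⟦ t ≡ᵇ k ⟧ ≡⟨ cong (_* ⟦ t ≡ᵇ k ⟧) (trans (#-level t t) (nCn≡1 t)) ⟩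
  1 * ⟦ t ≡ᵇ k ⟧ ≡⟨ trans (*-identityˡ _) (sym (wt0 k t)) ⟩
  wt 0 k t ∎
  where
  open ≡-Reasoning
  pointwise : ∀ (X : Subset t) → ⟦ level t X ∧ level k X ⟧ ≡ ⟦ level t X ⟧ * ⟦ t ≡ᵇ k ⟧
  pointwise X with level t X in eq
  ... | false = refl
  ... | true rewrite ≡ᵇ-sound ∣ X ∣ t eq = sym (+-identityʳ _)
star-count (suc N) t zero = trans (cong₂ _+_ (star-count N t zero)
  (∑-zero {N + t} (λ X → cong ⟦_⟧ (∧-zeroʳ (star N t X))))) (sym (wt-pascal N zero t))
star-count (suc N) t (suc k) = trans (cong₂ _+_ (star-count N t (suc k)) (star-count N t k)) (sym (wt-pascal N (suc k) t))

star-cross : ∀ N t → Cross t (star N t) (star N t)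
star-cross zero t X Y p q = ≤-reflexive (sym (trans (cong ∣_∣ (trans (cong₂ _∩_ (full X p) (full Y q)) (∩-idem ⊤))) (∣⊤∣≡n t)))
  where
  full : ∀ (X : Subset t) → level t X ≡ true → X ≡ ⊤
  full X p = ∣p∣≡n⇒p≡⊤ (≡ᵇ-sound ∣ X ∣ t p)
star-cross (suc N) t (a ∷ X) (b ∷ Y) p q = ≤-trans (star-cross N t X Y p q) (∣p∣≤∣x∷p∣ (a ∧ b) (X ∩ Y))

star-family : ∀ {n} N t κ → n ≡ N + t → ∃[ G ] KFamily n (t + κ) G × Intersecting t G × length G ≡ N C κ
star-family N t κ refl = members h ,
  (members-unique h , All.tabulate (λ X∈ → ≡ᵇ-sound _ _ (proj₂ (split (members-sound h X∈))))) ,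
  (λ X∈ Y∈ → star-cross N t _ _ (proj₁ (split (members-sound h X∈))) (proj₁ (split (members-sound h Y∈)))) ,
  trans (members-length h) (trans (star-count N t (t + κ)) (wt-+ N t κ))
  where
  h : Fam (N + t)
  h X = star N t X ∧ level (t + κ) X
  split : ∀ {X} → h X ≡ true → star N t X ≡ true × level (t + κ) X ≡ true
  split {X} = ∧-split {star N t X}

square-cancel : ∀ {m n} → m * m ≤ n * n → m ≤ n
square-cancel {m} {n} le = ≮⇒≥ λ n<m → <⇒≱ (*-mono-< n<m n<m) le

Equality : ∀ (n k t c : ℕ) (A B : Family n) → Set
Equality n k t c A B = (length A * length B ≤ c ^ 2) ×
  ((length A * length B ≡ c ^ 2) ⇔ (SameFamily A B × MaxIntersecting n k t A))

-- The theorem for families given as lists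

module _ {t₁ κ z N₀ n : ℕ} (t₁≥2 : 2 ≤ t₁) (size₀ : N₀ + suc t₁ ≡ suc (suc t₁) * suc κ + z) (eq : n ≡ N₀ + suc t₁) where

  private
    k = suc t₁ + κ
    t = suc t₁
    c = N₀ C κ

    k≡ : k ≡ t₁ + suc κ
    k≡ = sym (+-suc t₁ κ)

    c² : c * c ≡ c ^ 2
    c² = cong (c *_) (sym (*-identityʳ c))

    uniform : ∀ {A : Family n} → KFamily n k A → Uniform (t₁ + suc κ) (indicator A)
    uniform (_ , all) X q = trans (All.lookup all (∈-indicator q)) k≡

    cross : ∀ {A B : Family n} → CrossIntersecting t A B → Cross t (indicator A) (indicator B)
    cross cr X Y p q = cr (∈-indicator p) (∈-indicator q)

    cards : ∀ {A B : Family n} → KFamily n k A → KFamily n k B →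
            card (indicator A) * card (indicator B) ≡ length A * length B
    cards (uA , _) (uB , _) = cong₂ _*_ (card-indicator uA) (card-indicator uB)

    bound : ∀ {A B : Family n} → KFamily n k A → KFamily n k B → CrossIntersecting t A B → length A * length B ≤ c * c
    bound {A} {B} kA kB cr = subst (_≤ c * c) (cards kA kB)
      (Theorem.product-bound t₁ κ z N₀ t₁≥2 size₀ eq (indicator A) (indicator B) (uniform kA) (uniform kB) (cross cr))

    same-length : ∀ {A B : Family n} → KFamily n k A → KFamily n k B → SameFamily A B → length A ≡ length B
    same-length {A} {B} (uA , _) (uB , _) same = trans (sym (card-indicator uA))
      (trans (∑-cong (λ X → cong ⟦_⟧ (agree X))) (card-indicator uB))
      where
      agree : ∀ X → indicator A X ≡ indicator B X
      agree X with X ∈ˢ? A | X ∈ˢ? B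
      ... | yes _ | yes _ = refl
      ... | no _  | no _ = refl
      ... | yes p | no ¬q = contradiction (Equivalence.to (same X) p) ¬q
      ... | no ¬p | yes q = contradiction (Equivalence.from (same X) q) ¬p

  cross-intersecting-theorem : (A B : Family n) → KFamily n k A → KFamily n k B → CrossIntersecting t A B → Equality n k t c A B
  cross-intersecting-theorem A B kA kB cr = subst (length A * length B ≤_) c² (bound kA kB cr) , mk⇔ forward backward
    where
    forward : length A * length B ≡ c ^ 2 → SameFamily A B × MaxIntersecting n k t A
    forward e with Theorem.extremal t₁ κ z N₀ t₁≥2 size₀ eq (indicator A) (indicator B) (uniform kA) (uniform kB) (cross cr)
                     (trans (cards kA kB) (trans e (sym c²)))
    ... | r , _ , U , _ , tA , tB = same , kA , (λ X∈ Y∈ → cr X∈ (Equivalence.to (same _) Y∈)) , largest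
      where
      same : SameFamily A B
      same X = mk⇔
        (λ X∈ → let a , b = Threshold.to tA X (indicator-∈ X∈) in ∈-indicator (Threshold.from tB X a b))
        (λ X∈ → let a , b = Threshold.to tB X (indicator-∈ X∈) in ∈-indicator (Threshold.from tA X a b))
      largest : ∀ G → KFamily n k G → Intersecting t G → length G ≤ length A
      -- Maximality is the product bound for the pair (G, G).
      largest G kG iG = square-cancel (≤-trans (bound kG kG iG)
        (≤-reflexive (trans c² (trans (sym e) (cong (length A *_) (sym (same-length kA kB same)))))))
    backward : SameFamily A B × MaxIntersecting n k t A → length A * length B ≡ c ^ 2
    -- The star shows that a maximum family has at least c members.
    backward (same , _ , _ , largest) with star-family N₀ t κ eq
    ... | G , kG , iG , len = ≤-antisym (subst (length A * length B ≤_) c² (bound kA kB cr))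
      (subst₂ _≤_ c² (cong (length A *_) (same-length kA kB same)) (*-mono-≤ c≤A c≤A))
      where
      c≤A : c ≤ length A
      c≤A = subst (_≤ length A) len (largest G kG iG)

theorem1p6 : (n k t : ℕ) → 3 ≤ t → t ≤ k → k ≤ n → (t + 1) * (k ∸ t + 1) ≤ n →
    (A B : Family n) → KFamily n k A → KFamily n k B → CrossIntersecting t A B →
    (length A * length B ≤ ((n ∸ t) C (k ∸ t)) ^ 2) ×
    ((length A * length B ≡ ((n ∸ t) C (k ∸ t)) ^ 2) ⇔ (SameFamily A B × MaxIntersecting n k t A))
theorem1p6 n k t@(suc t₁) (s≤s t₁≥2) t≤k k≤n large A B with ≤-witness large
... | z , n≡ = subst
  (λ k' → KFamily n k' A → KFamily n k' B → CrossIntersecting t A B →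
    (length A * length B ≤ ((n ∸ t) C (k ∸ t)) ^ 2) ×
    ((length A * length B ≡ ((n ∸ t) C (k ∸ t)) ^ 2) ⇔ (SameFamily A B × MaxIntersecting n k' t A)))
  (m+[n∸m]≡n t≤k)
  (cross-intersecting-theorem {t₁} {k ∸ t} {z} {n ∸ t} t₁≥2
    (trans (m∸n+n≡m t≤n) (trans n≡ (cong (_+ z) (cong₂ _*_ (+-comm t 1) (+-comm (k ∸ t) 1)))))
    (sym (m∸n+n≡m t≤n)) A B)
  where
  t≤n : t ≤ n
  t≤n = ≤-trans t≤k k≤n
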